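{- Let $G=(V,E)$ be a graph, let $(G,p)$ be a generic complex realisation of $G$, and let $u,v,v_1,v_2,v_3,v_n\in V$ with $N(v_n)=\{v_1,v_2,v_3\}$ and $v_n\ne u,v$. Let $H=G-v_n+v_1v_2$. Suppose that $G-v_n$ is rigid and that $\{u,v\}$ is globally linked in $(H,p|_{V-v_n})$. Then $\{u,v\}$ is globally linked in $(G,p)$.
   Context: A complex realisation of a finite graph $G=(V,E)$ is a map $p:V\to\mathbb{C}^2$. For $P=(x,y)\in\mathbb{C}^2$ put $d(P)=x^2+y^2$. Realisations $(G,p),(G,q)$ are equivalent if $d(p(u)-p(v))=d(q(u)-q(v))$ for all $uv\in E$. A realisation is generic if the set of all coordinates of the points $p(v)$ is algebraically independent over $\mathbb{Q}$. The rigidity matrix $R(G,p)$ is the $|E|\times2|V|$ matrix whose row for edge $uv$ has $p(u)-p(v)$ in the columns of $u$, $p(v)-p(u)$ in the columns of $v$, zeros elsewhere; a graph is rigid if $\operatorname{rank}R(G,p)=2|V|-3$ for a generic real realisation $p$. For a complex realisation $(G,p)$ and $u,v\in V$, the pair $\{u,v\}$ is globally linked in $(G,p)$ if every complex realisation $(G,q)$ equivalent to $(G,p)$ satisfies $d(p(u)-p(v))=d(q(u)-q(v))$. -}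

module Defs where

open import Level using (0ℓ)
open import Algebra.Bundles.Raw using (RawRing)
import Algebra.Definitions.RawMonoid as RawMonoidDefs
open import Data.Bool.Base using (if_then_else_)
open import Data.Fin.Base as Fin using (Fin; zero; suc; punchIn)
import Data.Fin.Properties as Fin
open import Data.List.Base as List using (List; allFin; cartesianProduct; filter; length)
open import Data.List.Relation.Unary.All using (All)
open import Data.Nat.Base as ℕ using (ℕ; zero; suc)
import Data.Nat.Properties as ℕ
open import Data.Product.Base using (∃; _×_; _,_; proj₁; proj₂)
open import Data.Rational.Base as ℚ using (ℚ; 0ℚ; 1ℚ; ½; ∣_∣; 1/_)
import Data.Rational.Properties as ℚ
open import Data.Rational.Solver using (module +-*-Solver)
open import Data.Sum.Base using (_⊎_; inj₁; inj₂)
open import Data.Vec.Functional as Vector using (Vector)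
open import Function.Base using (_∘_)
open import Relation.Binary.Core using (Rel)
open import Relation.Binary.Definitions using (Decidable; Irreflexive; Symmetric)
open import Relation.Binary.PropositionalEquality
  using (_≡_; _≢_; refl; sym; trans; cong; subst)
open import Relation.Nullary.Decidable using (does; ¬?; _×-dec_; _⊎-dec_)
open import Relation.Nullary.Negation using (¬_)
open import Relation.Unary using (Pred)

------------------------------------------------------------------------
-- The real numbers: Cauchy sequences of rationals, with the difference
-- tending to 0 as (setoid) equality.

Cauchy : (ℕ → ℚ) → Set
Cauchy f = ∀ ε → 0ℚ ℚ.< ε → ∃ λ N → ∀ m n → N ℕ.≤ m → N ℕ.≤ n →
  ∣ f m ℚ.- f n ∣ ℚ.< ε

record ℝ : Set where
  constructor mkℝ
  field
    seq    : ℕ → ℚ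
    cauchy : Cauchy seq

open ℝ public

infix 4 _≈ᵣ_

_≈ᵣ_ : Rel ℝ 0ℓ
x ≈ᵣ y = ∀ ε → 0ℚ ℚ.< ε → ∃ λ N → ∀ n → N ℕ.≤ n →
  ∣ seq x n ℚ.- seq y n ∣ ℚ.< ε

abstract
  half-pos : ∀ ε → 0ℚ ℚ.< ε → 0ℚ ℚ.< ½ ℚ.* ε
  half-pos ε 0<ε = subst (ℚ._< ½ ℚ.* ε) (ℚ.*-zeroʳ ½) (ℚ.*-monoʳ-<-pos ½ 0<ε)

  half+half : ∀ ε → ½ ℚ.* ε ℚ.+ ½ ℚ.* ε ≡ ε
  half+half ε = trans (sym (ℚ.*-distribʳ-+ ε ½ ½)) (ℚ.*-identityˡ ε)

  const-cauchy : ∀ q → Cauchy (λ _ → q)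
  const-cauchy q ε 0<ε = 0 , λ _ _ _ _ →
    subst (λ r → ∣ r ∣ ℚ.< ε) (sym (ℚ.+-inverseʳ q)) 0<ε

  +-cauchy : ∀ {f g} → Cauchy f → Cauchy g → Cauchy (λ n → f n ℚ.+ g n)
  +-cauchy {f} {g} cf cg ε 0<ε
    with cf (½ ℚ.* ε) (half-pos ε 0<ε) | cg (½ ℚ.* ε) (half-pos ε 0<ε)
  ... | M , hf | N , hg = M ℕ.⊔ N , λ m n m≥ n≥ → begin-strict
      ∣ (f m ℚ.+ g m) ℚ.- (f n ℚ.+ g n) ∣
        ≡⟨ cong ∣_∣ (rearrange (f m) (g m) (f n) (g n)) ⟩
      ∣ (f m ℚ.- f n) ℚ.+ (g m ℚ.- g n) ∣
        ≤⟨ ℚ.∣p+q∣≤∣p∣+∣q∣ (f m ℚ.- f n) (g m ℚ.- g n) ⟩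
      ∣ f m ℚ.- f n ∣ ℚ.+ ∣ g m ℚ.- g n ∣
        <⟨ ℚ.+-mono-< (hf m n (ℕ.m⊔n≤o⇒m≤o M N m≥) (ℕ.m⊔n≤o⇒m≤o M N n≥))
                      (hg m n (ℕ.m⊔n≤o⇒n≤o M N m≥) (ℕ.m⊔n≤o⇒n≤o M N n≥)) ⟩
      ½ ℚ.* ε ℚ.+ ½ ℚ.* ε
        ≡⟨ half+half ε ⟩
      ε ∎
    where
    open ℚ.≤-Reasoning
    rearrange : ∀ a b c d → (a ℚ.+ b) ℚ.- (c ℚ.+ d) ≡ (a ℚ.- c) ℚ.+ (b ℚ.- d)
    rearrange = solve 4 (λ a b c d → (a :+ b) :- (c :+ d) := (a :- c) :+ (b :- d)) refl
      where open +-*-Solver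

  neg-cauchy : ∀ {f} → Cauchy f → Cauchy (λ n → ℚ.- f n)
  neg-cauchy {f} cf ε 0<ε with cf ε 0<ε
  ... | N , h = N , λ m n m≥ n≥ →
      subst (ℚ._< ε) (trans (sym (ℚ.∣-p∣≡∣p∣ (f m ℚ.- f n)))
                            (cong ∣_∣ (rearrange (f m) (f n))))
            (h m n m≥ n≥)
    where
    rearrange : ∀ a b → ℚ.- (a ℚ.- b) ≡ (ℚ.- a) ℚ.- (ℚ.- b)
    rearrange = solve 2 (λ a b → :- (a :- b) := (:- a) :- (:- b)) refl
      where open +-*-Solver

  bounded : ∀ {f} → Cauchy f →
    ∃ λ B → ∃ λ N → 0ℚ ℚ.< B × (∀ n → N ℕ.≤ n → ∣ f n ∣ ℚ.≤ B)
  bounded {f} cf with cf 1ℚ (ℚ.positive⁻¹ 1ℚ)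
  ... | N , h = 1ℚ ℚ.+ ∣ f N ∣ , N ,
      ℚ.+-mono-<-≤ (ℚ.positive⁻¹ 1ℚ) (ℚ.0≤∣p∣ (f N)) , λ n n≥ → begin
        ∣ f n ∣                        ≡⟨ cong ∣_∣ (rearrange (f n) (f N)) ⟩
        ∣ (f n ℚ.- f N) ℚ.+ f N ∣      ≤⟨ ℚ.∣p+q∣≤∣p∣+∣q∣ (f n ℚ.- f N) (f N) ⟩
        ∣ f n ℚ.- f N ∣ ℚ.+ ∣ f N ∣
          ≤⟨ ℚ.+-monoˡ-≤ ∣ f N ∣ (ℚ.<⇒≤ (h n N n≥ ℕ.≤-refl)) ⟩
        1ℚ ℚ.+ ∣ f N ∣                 ∎
    where
    open ℚ.≤-Reasoning
    rearrange : ∀ a b → a ≡ (a ℚ.- b) ℚ.+ b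
    rearrange = solve 2 (λ a b → a := (a :- b) :+ b) refl
      where open +-*-Solver

  scale : ∀ C ε → 0ℚ ℚ.< C → 0ℚ ℚ.< ε → ∃ λ δ → 0ℚ ℚ.< δ × C ℚ.* δ ≡ ε
  scale C ε 0<C 0<ε = 1/ C ℚ.* ε
    , subst (ℚ._< 1/ C ℚ.* ε) (ℚ.*-zeroʳ (1/ C)) (ℚ.*-monoʳ-<-pos (1/ C) 0<ε)
    , trans (sym (ℚ.*-assoc C (1/ C) ε))
        (trans (cong (ℚ._* ε) (ℚ.*-inverseʳ C)) (ℚ.*-identityˡ ε))
    where
    instance
      C-pos : ℚ.Positive C
      C-pos = ℚ.positive 0<C

      C-nonZero : ℚ.NonZero C
      C-nonZero = ℚ.pos⇒nonZero C

      C⁻¹-pos : ℚ.Positive (1/ C)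
      C⁻¹-pos = ℚ.1/pos⇒pos C

  small : ∀ {C δ η} a x → 0ℚ ℚ.< C → C ℚ.* δ ≡ η →
    ∣ a ∣ ℚ.≤ C → ∣ x ∣ ℚ.< δ → ∣ a ℚ.* x ∣ ℚ.< η
  small {C} {δ} {η} a x 0<C Cδ≡η a≤C x<δ = begin-strict
    ∣ a ℚ.* x ∣       ≡⟨ ℚ.∣p*q∣≡∣p∣*∣q∣ a x ⟩
    ∣ a ∣ ℚ.* ∣ x ∣   ≤⟨ ℚ.*-monoʳ-≤-nonNeg ∣ x ∣ {{ℚ.nonNegative (ℚ.0≤∣p∣ x)}} a≤C ⟩
    C ℚ.* ∣ x ∣       <⟨ ℚ.*-monoʳ-<-pos C {{ℚ.positive 0<C}} x<δ ⟩
    C ℚ.* δ           ≡⟨ Cδ≡η ⟩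
    η                 ∎
    where open ℚ.≤-Reasoning

  product-difference : ∀ a b x y →
    a ℚ.* b ℚ.- x ℚ.* y ≡ a ℚ.* (b ℚ.- y) ℚ.+ y ℚ.* (a ℚ.- x)
  product-difference = solve 4 (λ a b x y →
    a :* b :- x :* y := a :* (b :- y) :+ y :* (a :- x)) refl
    where open +-*-Solver

  close : ∀ {A B δ δ′ η} a b x y → 0ℚ ℚ.< A → 0ℚ ℚ.< B →
    A ℚ.* δ ≡ η → B ℚ.* δ′ ≡ η → ∣ a ∣ ℚ.≤ A → ∣ y ∣ ℚ.≤ B →
    ∣ b ℚ.- y ∣ ℚ.< δ → ∣ a ℚ.- x ∣ ℚ.< δ′ → ∣ a ℚ.* b ℚ.- x ℚ.* y ∣ ℚ.< η ℚ.+ η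
  close {η = η} a b x y 0<A 0<B Aδ≡η Bδ′≡η a≤A y≤B b-y<δ a-x<δ′ = begin-strict
    ∣ a ℚ.* b ℚ.- x ℚ.* y ∣
      ≡⟨ cong ∣_∣ (product-difference a b x y) ⟩
    ∣ a ℚ.* (b ℚ.- y) ℚ.+ y ℚ.* (a ℚ.- x) ∣
      ≤⟨ ℚ.∣p+q∣≤∣p∣+∣q∣ (a ℚ.* (b ℚ.- y)) (y ℚ.* (a ℚ.- x)) ⟩
    ∣ a ℚ.* (b ℚ.- y) ∣ ℚ.+ ∣ y ℚ.* (a ℚ.- x) ∣
      <⟨ ℚ.+-mono-< (small a (b ℚ.- y) 0<A Aδ≡η a≤A b-y<δ)
                    (small y (a ℚ.- x) 0<B Bδ′≡η y≤B a-x<δ′) ⟩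
    η ℚ.+ η ∎
    where open ℚ.≤-Reasoning

  *-cauchy : ∀ {f g} → Cauchy f → Cauchy g → Cauchy (λ n → f n ℚ.* g n)
  *-cauchy {f} {g} cf cg ε 0<ε =
    let A , K , 0<A , f≤A = bounded {f} cf
        B , L , 0<B , g≤B = bounded {g} cg
        δ  , 0<δ  , Aδ≡  = scale A (½ ℚ.* ε) 0<A (half-pos ε 0<ε)
        δ′ , 0<δ′ , Bδ′≡ = scale B (½ ℚ.* ε) 0<B (half-pos ε 0<ε)
        M , hf = cf δ′ 0<δ′
        N , hg = cg δ 0<δ
    in (K ℕ.⊔ L) ℕ.⊔ (M ℕ.⊔ N) , λ m n m≥ n≥ →
      let m≥′ = ℕ.m⊔n≤o⇒n≤o (K ℕ.⊔ L) (M ℕ.⊔ N) m≥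
          n≥′ = ℕ.m⊔n≤o⇒n≤o (K ℕ.⊔ L) (M ℕ.⊔ N) n≥
      in subst (∣ f m ℚ.* g m ℚ.- f n ℚ.* g n ∣ ℚ.<_) (half+half ε)
          (close (f m) (g m) (f n) (g n) 0<A 0<B Aδ≡ Bδ′≡
            (f≤A m (ℕ.m⊔n≤o⇒m≤o K L (ℕ.m⊔n≤o⇒m≤o (K ℕ.⊔ L) (M ℕ.⊔ N) m≥)))
            (g≤B n (ℕ.m⊔n≤o⇒n≤o K L (ℕ.m⊔n≤o⇒m≤o (K ℕ.⊔ L) (M ℕ.⊔ N) n≥)))
            (hg m n (ℕ.m⊔n≤o⇒n≤o M N m≥′) (ℕ.m⊔n≤o⇒n≤o M N n≥′))
            (hf m n (ℕ.m⊔n≤o⇒m≤o M N m≥′) (ℕ.m⊔n≤o⇒m≤o M N n≥′)))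

fromℚ : ℚ → ℝ
fromℚ q = mkℝ (λ _ → q) (const-cauchy q)

infixl 6 _+ᵣ_ _-ᵣ_
infixl 7 _*ᵣ_
infix  8 -ᵣ_

-ᵣ_ : ℝ → ℝ
(-ᵣ mkℝ f cf) = mkℝ (λ n → ℚ.- f n) (neg-cauchy {f} cf)

_+ᵣ_ _*ᵣ_ _-ᵣ_ : ℝ → ℝ → ℝ
mkℝ f cf +ᵣ mkℝ g cg = mkℝ (λ n → f n ℚ.+ g n) (+-cauchy {f} {g} cf cg)
mkℝ f cf *ᵣ mkℝ g cg = mkℝ (λ n → f n ℚ.* g n) (*-cauchy {f} {g} cf cg)
x -ᵣ y = x +ᵣ (-ᵣ y)

ℝ-rawRing : RawRing 0ℓ 0ℓ
ℝ-rawRing = record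
  { Carrier = ℝ
  ; _≈_     = _≈ᵣ_
  ; _+_     = _+ᵣ_
  ; _*_     = _*ᵣ_
  ; -_      = -ᵣ_
  ; 0#      = fromℚ 0ℚ
  ; 1#      = fromℚ 1ℚ
  }

------------------------------------------------------------------------
-- The complex numbers.

record ℂ : Set where
  constructor _+i_
  field
    re im : ℝ

open ℂ public

ℂ-rawRing : RawRing 0ℓ 0ℓ
ℂ-rawRing = record
  { Carrier = ℂ
  ; _≈_     = λ z w → (re z ≈ᵣ re w) × (im z ≈ᵣ im w)
  ; _+_     = λ z w → (re z +ᵣ re w) +i (im z +ᵣ im w)
  ; _*_     = λ z w → (re z *ᵣ re w -ᵣ im z *ᵣ im w) +i (re z *ᵣ im w +ᵣ im z *ᵣ re w)
  ; -_      = λ z → (-ᵣ re z) +i (-ᵣ im z)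
  ; 0#      = fromℚ 0ℚ +i fromℚ 0ℚ
  ; 1#      = fromℚ 1ℚ +i fromℚ 0ℚ
  }

ℚ→ℂ : ℚ → ℂ
ℚ→ℂ q = fromℚ q +i fromℚ 0ℚ

------------------------------------------------------------------------
-- Finite simple graphs on the vertex set Fin n.

record Graph (n : ℕ) : Set₁ where
  field
    _~_      : Rel (Fin n) 0ℓ
    ~-dec    : Decidable _~_
    ~-sym    : Symmetric _~_
    ~-irrefl : Irreflexive _≡_ _~_

  N : Fin n → Pred (Fin n) 0ℓ
  N v w = v ~ w

  -- Each edge is listed once, smaller endpoint first.
  edges : List (Fin n × Fin n)
  edges = filter (λ e → proj₁ e Fin.<? proj₂ e ×-dec ~-dec (proj₁ e) (proj₂ e))
                 (cartesianProduct (allFin n) (allFin n))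

  N⇒≢ : ∀ {v w} → N v w → v ≢ w
  N⇒≢ v~w v≡w = ~-irrefl v≡w v~w

open Graph public using (N; N⇒≢; edges)

-- The vertices of G - v are numbered through punchIn v : Fin n → Fin (suc n),
-- the order-preserving injection whose image is everything except v.
infixl 6 _-_

_-_ : ∀ {n} → Graph (suc n) → Fin (suc n) → Graph n
G - v = record
  { _~_      = λ a b → punchIn v a ~ punchIn v b
  ; ~-dec    = λ a b → ~-dec (punchIn v a) (punchIn v b)
  ; ~-sym    = ~-sym
  ; ~-irrefl = λ a≡b → ~-irrefl (cong (punchIn v) a≡b)
  }
  where open Graph G

-- Adding an edge that is already present changes nothing; the conjunct
-- a ≢ b means that the same holds for a loop.
infixl 6 _+⟨_,_⟩

_+⟨_,_⟩ : ∀ {n} → Graph n → Fin n → Fin n → Graph n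
G +⟨ u , v ⟩ = record
  { _~_      = λ a b → (a ~ b) ⊎ (a ≢ b × ((a ≡ u × b ≡ v) ⊎ (a ≡ v × b ≡ u)))
  ; ~-dec    = λ a b → ~-dec a b ⊎-dec (¬? (a Fin.≟ b) ×-dec
      ((a Fin.≟ u ×-dec b Fin.≟ v) ⊎-dec (a Fin.≟ v ×-dec b Fin.≟ u)))
  ; ~-sym    = λ where
      (inj₁ a~b)                    → inj₁ (~-sym a~b)
      (inj₂ (a≢b , inj₁ (eq , eq′))) → inj₂ ((λ b≡a → a≢b (sym b≡a)) , inj₂ (eq′ , eq))
      (inj₂ (a≢b , inj₂ (eq , eq′))) → inj₂ ((λ b≡a → a≢b (sym b≡a)) , inj₁ (eq′ , eq))
  ; ~-irrefl = λ where
      a≡b (inj₁ a~b)       → ~-irrefl a≡b a~b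
      a≡b (inj₂ (a≢b , _)) → a≢b a≡b
  }
  where open Graph G

------------------------------------------------------------------------
-- Polynomials over ℚ.

-- ℚ[X₁,…,Xₖ₊₁] as ℚ[X₂,…,Xₖ₊₁][X₁]: lists of coefficients, constant term
-- first.  Trailing zero coefficients are allowed, so being the zero
-- polynomial is the predicate IsZero rather than equality with [].
Poly : ℕ → Set
Poly zero    = ℚ
Poly (suc k) = List (Poly k)

IsZero : ∀ k → Poly k → Set
IsZero zero    q  = q ≡ 0ℚ
IsZero (suc k) cs = All (IsZero k) cs

------------------------------------------------------------------------
-- Linear algebra and realisations in K², where K is ℝ or ℂ and
-- ι is the inclusion of ℚ.

module Over (K : RawRing 0ℓ 0ℓ) (ι : ℚ → RawRing.Carrier K) where

  open RawRing K using (Carrier; _≈_; _+_; _*_; 0#; +-rawMonoid) renaming (-_ to neg)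
  open RawMonoidDefs +-rawMonoid using (sum)

  eval : ∀ k → Poly k → Vector Carrier k → Carrier
  eval zero    q  x = ι q
  eval (suc k) cs x =
    List.foldr (λ c acc → eval k c (Vector.tail x) + Vector.head x * acc) 0# cs

  -- Independence of the family x; in particular its members are distinct.
  AlgebraicallyIndependent : ∀ {k} → Vector Carrier k → Set
  AlgebraicallyIndependent {k} x = ∀ P → eval k P x ≈ 0# → IsZero k P

  Matrix : ℕ → ℕ → Set
  Matrix m n = Vector (Vector Carrier n) m

  LinearlyIndependent : ∀ {m n} → Matrix m n → Set
  LinearlyIndependent {m} M =
    ∀ (c : Vector Carrier m) → (∀ j → sum (λ i → c i * M i j) ≈ 0#) → ∀ i → c i ≈ 0#

  -- r is the largest number of linearly independent rows.  Selections of
  -- rows with repetitions need not be excluded: they are never independent.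
  HasRank : ∀ {m n} → Matrix m n → ℕ → Set
  HasRank {m} M r =
    (∃ λ (s : Fin r → Fin m) → LinearlyIndependent (M ∘ s)) ×
    (∀ (s : Fin (suc r) → Fin m) → ¬ LinearlyIndependent (M ∘ s))

  Point : Set
  Point = Vector Carrier 2

  infixl 6 _⊖_

  _⊖_ : Point → Point → Point
  (P ⊖ Q) i = P i + neg (Q i)

  d : Point → Carrier
  d P = P zero * P zero + P (suc zero) * P (suc zero)

  Realisation : ℕ → Set
  Realisation n = Fin n → Point

  Generic : ∀ {n} → Realisation n → Set
  Generic p = AlgebraicallyIndependent (Vector.concat p)

  Equivalent : ∀ {n} → Graph n → Realisation n → Realisation n → Set
  Equivalent G p q = ∀ u v → u ~ v → d (p u ⊖ p v) ≈ d (q u ⊖ q v)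
    where open Graph G

  GloballyLinked : ∀ {n} → Graph n → Realisation n → Fin n → Fin n → Set
  GloballyLinked G p u v = ∀ q → Equivalent G p q → d (p u ⊖ p v) ≈ d (q u ⊖ q v)

  -- Columns 2w and 2w+1 belong to the vertex w.
  rigidityMatrix : ∀ {n} (G : Graph n) → Realisation n → Matrix (length (edges G)) (n ℕ.* 2)
  rigidityMatrix G p i = Vector.concat λ w →
    if does (w Fin.≟ u) then p u ⊖ p v
    else if does (w Fin.≟ v) then p v ⊖ p u
    else λ _ → 0#
    where
    u = proj₁ (List.lookup (edges G) i)
    v = proj₂ (List.lookup (edges G) i)

module Real    = Over ℝ-rawRing fromℚ
module Complex = Over ℂ-rawRing ℚ→ℂ

-- r + 3 ≡ 2 * n is r = 2n - 3 without truncated subtraction.  The rank is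
-- the same for all generic real realisations, and these exist, so asking for
-- "some" is asking for "every".
Rigid : ∀ {n} → Graph n → Set
Rigid {n} G = ∃ λ (p : Real.Realisation n) → Real.Generic p ×
  ∃ λ r → Real.HasRank (Real.rigidityMatrix G p) r × (r ℕ.+ 3 ≡ 2 ℕ.* n)

{-# OPTIONS --safe #-}

-- Every q equivalent to p is differentiated along the generic p.  Since the
-- coordinates of p are algebraically independent, any velocity of p extends,
-- up to a nonzero scalar, to a derivation of ℚ[p , q]; it gives velocities δ
-- of p and δ′ of q with (q a - q b)·(δ′ a - δ′ b) = (p a - p b)·(δ a - δ b)
-- on every edge.  As the rows of R(G - vₙ , p) span a space of dimension
-- 2n - 3, where n is the number of vertices of G - vₙ, so do those of
-- R(G - vₙ , q), and the only infinitesimal flexes of q are trivial.  Moving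
-- vₙ alone in p hence moves, after subtracting a trivial motion, vₙ alone in
-- q, and the equations at the three edges of vₙ say that one linear map N
-- takes q vₙ - q vᵢ to p vₙ - p vᵢ for i = 1, 2, 3.  Lengths agree on these
-- three pairwise independent vectors, so N is orthogonal, and v₁v₂ has the
-- same length in p and q; q is therefore equivalent to p on H.
--
-- All case distinctions are made under a double negation, which is harmless
-- because equality in ℝ and ℂ is ¬¬-stable.  Inverses are avoided by carrying
-- nonzero scalars along.

module Submission where

open import Defs
open import Level using (0ℓ)
open import Algebra.Bundles using (CommutativeRing)
open import Algebra.Bundles.Raw using (RawRing)
import Algebra.Morphism.RingMonomorphism as RingMonomorphism
open import Algebra.Morphism.Structures using (module RingMorphisms)
import Algebra.Properties.Ring as RingProperties
import Algebra.Properties.Semiring.Sum as SemiringSum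
import Algebra.Solver.Ring
import Algebra.Solver.Ring.AlmostCommutativeRing as ACR
open import Data.Bool.Base using (if_then_else_; true; false)
open import Data.Empty using (⊥-elim)
open import Data.Fin.Base as Fin
  using (Fin; zero; suc; punchIn; punchOut; _↑ˡ_; _↑ʳ_; combine; remQuot)
import Data.Fin.Properties as Fin
open import Data.List.Base as List using (List; []; _∷_; length)
open import Data.List.Membership.Propositional.Properties using (∈-lookup)
import Data.List.Relation.Unary.All as All
open import Data.List.Relation.Unary.All using ([]; _∷_)
import Data.List.Relation.Unary.All.Properties as All
import Data.Maybe.Base as Maybe
open import Data.Nat.Base as ℕ using (ℕ; zero; suc)
open import Data.Nat.Divisibility using (_∣?_; divides)
import Data.Nat.Properties as ℕ
open import Data.Product.Base using (_×_; _,_; proj₁; proj₂; ∃; Σ; uncurry)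
open import Data.Rational.Base as ℚ using (ℚ; 0ℚ; 1ℚ; ½; ∣_∣)
import Data.Rational.Properties as ℚ
open import Data.Rational.Solver using (module +-*-Solver)
open import Data.Sum.Base using (_⊎_; inj₁; inj₂)
open import Data.Vec.Base as Vec using (Vec; []; _∷_; _∷ʳ_)
open import Data.Vec.Functional as Vector using (Vector)
open import Data.Vec.Functional.Properties using (insertAt-lookup; insertAt-punchIn)
open import Data.Vec.Relation.Unary.All as VecAll using ([]; _∷_)
open import Function.Base using (_∘_; id)
open import Relation.Binary.PropositionalEquality as ≡ using (_≡_; _≢_)
import Relation.Binary.Reasoning.Setoid as SetoidReasoning
open import Relation.Nullary.Decidable using (does; yes; no; from-no; dec⇒maybe; _×-dec_)
open import Relation.Nullary.Negation.Core using (¬_)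
open import Relation.Unary using (_≐_; _∪_; ｛_｝)

-- One obstacle is that `q` is an arbitrary point of a fibre: its coordinates may satisfy many
-- relations, so genericity says nothing directly about R(G - vₙ , q). Independence of rows is
-- therefore recorded by motions dual to the edges rather than by minors, because motions are what
-- differentiation carries from `p` to `q`.
--
-- The other obstacle is that rigidity speaks of some generic real realisation, while `p` is
-- complex. Both have algebraically independent coordinates over ℚ, so they satisfy the same
-- polynomial identities; elimination is done once, with polynomials as entries, and its outcome is
-- read at either point.
--
-- The nonzero scalars come from adjoining the coordinates of `q` one by one. A transcendental
-- coordinate may get any velocity; an algebraic one gets it by implicit differentiation of a
-- minimal relation, and the denominator of that quotient becomes the scalar.

-- ℚ-algebras with a ring solver

record ℚAlgebra : Set₁ where
  field
    commutativeRing : CommutativeRing 0ℓ 0ℓ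
  open CommutativeRing commutativeRing public hiding (_-_; zero)
  open RingMorphisms ℚ.+-*-rawRing rawRing using (IsRingHomomorphism)
  field
    ι     : ℚ → Carrier
    ι-hom : IsRingHomomorphism ι

  module ι = IsRingHomomorphism ι-hom
  open RingProperties ring public
    using (-0#≈0#; x∙y⁻¹≈ε⇒x≈y; x≈y⇒x∙y⁻¹≈ε)
  open SemiringSum semiring public
    using (sum; sum-cong-≋; sum-remove; ∑-distrib-+; *-distribˡ-sum)
  open SetoidReasoning setoid public

  -- Agrees with ι, but sends 0ℚ and 1ℚ to 0# and 1# on the nose, so that
  -- solver equations may contain these constants.
  coefficient : ℚ → Carrier
  coefficient q with q ℚ.≟ 0ℚ | q ℚ.≟ 1ℚ
  ... | yes _ | _     = 0#
  ... | no _  | yes _ = 1#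
  ... | no _  | no _  = ι q

  coefficient≈ι : ∀ q → coefficient q ≈ ι q
  coefficient≈ι q with q ℚ.≟ 0ℚ | q ℚ.≟ 1ℚ
  ... | yes ≡.refl | _          = sym ι.0#-homo
  ... | no _       | yes ≡.refl = sym ι.1#-homo
  ... | no _       | no _       = refl

  private
    coefficient-hom : ℚ.+-*-rawRing ACR.-Raw-AlmostCommutative⟶
                      ACR.fromCommutativeRing commutativeRing
    coefficient-hom = record
      { ⟦_⟧    = coefficient
      ; +-homo = λ p q → trans (coefficient≈ι (p ℚ.+ q)) (trans (ι.+-homo p q)
                   (sym (+-cong (coefficient≈ι p) (coefficient≈ι q))))
      ; *-homo = λ p q → trans (coefficient≈ι (p ℚ.* q)) (trans (ι.*-homo p q)
                   (sym (*-cong (coefficient≈ι p) (coefficient≈ι q))))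
      ; -‿homo = λ p → trans (coefficient≈ι (ℚ.- p)) (trans (ι.-‿homo p)
                   (sym (-‿cong (coefficient≈ι p))))
      ; 0-homo = refl
      ; 1-homo = refl
      }

  module Solver = Algebra.Solver.Ring ℚ.+-*-rawRing
    (ACR.fromCommutativeRing commutativeRing) coefficient-hom
    (λ p q → Maybe.map (λ p≡q → reflexive (≡.cong coefficient p≡q)) (dec⇒maybe (p ℚ.≟ q)))

-- Polynomials and their values

constᴾ : ∀ k → ℚ → Poly k
constᴾ zero    q = q
constᴾ (suc k) q = constᴾ k q ∷ []

varᴾ : ∀ {k} → Fin k → Poly k
varᴾ {suc k} zero    = constᴾ k 0ℚ ∷ constᴾ k 1ℚ ∷ []
varᴾ {suc k} (suc i) = varᴾ i ∷ []

addᴾ : ∀ k → Poly k → Poly k → Poly k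
addᴾ zero    p q = p ℚ.+ q
addᴾ (suc k) [] qs = qs
addᴾ (suc k) ps@(_ ∷ _) [] = ps
addᴾ (suc k) (p ∷ ps) (q ∷ qs) = addᴾ k p q ∷ addᴾ (suc k) ps qs

mulᴾ : ∀ k → Poly k → Poly k → Poly k
mulᴾ zero    p q = p ℚ.* q
mulᴾ (suc k) [] qs = []
mulᴾ (suc k) (p ∷ ps) qs =
  addᴾ (suc k) (List.map (mulᴾ k p) qs) (constᴾ k 0ℚ ∷ mulᴾ (suc k) ps qs)

negᴾ : ∀ k → Poly k → Poly k
negᴾ k = mulᴾ k (constᴾ k (ℚ.- 1ℚ))

module Evaluation (R : ℚAlgebra) where
  open ℚAlgebra R
  open Over rawRing ι public using (eval)
  open Solver

  eval-const : ∀ k q x → eval k (constᴾ k q) x ≈ ι q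
  eval-const zero    q x = refl
  eval-const (suc k) q x = begin
    eval k (constᴾ k q) (Vector.tail x) + Vector.head x * 0#
      ≈⟨ +-cong (eval-const k q (Vector.tail x)) (zeroʳ (Vector.head x)) ⟩
    ι q + 0#   ≈⟨ +-identityʳ (ι q) ⟩
    ι q        ∎

  eval-add : ∀ k P Q x → eval k (addᴾ k P Q) x ≈ eval k P x + eval k Q x
  eval-add zero    p q x = ι.+-homo p q
  eval-add (suc k) [] qs x = sym (+-identityˡ _)
  eval-add (suc k) (p ∷ ps) [] x = sym (+-identityʳ _)
  eval-add (suc k) (p ∷ ps) (q ∷ qs) x = begin
    eval k (addᴾ k p q) t + h * eval (suc k) (addᴾ (suc k) ps qs) x
      ≈⟨ +-cong (eval-add k p q t) (*-congˡ (eval-add (suc k) ps qs x)) ⟩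
    (eval k p t + eval k q t) + h * (eval (suc k) ps x + eval (suc k) qs x)
      ≈⟨ solve 5 (λ a b h c d → (a :+ b) :+ h :* (c :+ d) := (a :+ h :* c) :+ (b :+ h :* d))
           refl _ _ _ _ _ ⟩
    (eval k p t + h * eval (suc k) ps x) + (eval k q t + h * eval (suc k) qs x) ∎
    where
    h = Vector.head x
    t = Vector.tail x

  eval-mul : ∀ k P Q x → eval k (mulᴾ k P Q) x ≈ eval k P x * eval k Q x
  eval-mul zero    p q x = ι.*-homo p q
  eval-mul (suc k) [] qs x = sym (zeroˡ _)
  eval-mul (suc k) (p ∷ ps) qs x = begin
    eval (suc k) (addᴾ (suc k) (List.map (mulᴾ k p) qs) (constᴾ k 0ℚ ∷ mulᴾ (suc k) ps qs)) x
      ≈⟨ eval-add (suc k) (List.map (mulᴾ k p) qs) _ x ⟩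
    eval (suc k) (List.map (mulᴾ k p) qs) x
      + (eval k (constᴾ k 0ℚ) t + h * eval (suc k) (mulᴾ (suc k) ps qs) x)
      ≈⟨ +-cong (eval-map qs)
           (+-cong (trans (eval-const k 0ℚ t) ι.0#-homo) (*-congˡ (eval-mul (suc k) ps qs x))) ⟩
    eval k p t * eval (suc k) qs x + (0# + h * (eval (suc k) ps x * eval (suc k) qs x))
      ≈⟨ solve 4 (λ a h b c → a :* c :+ (con 0ℚ :+ h :* (b :* c)) := (a :+ h :* b) :* c)
           refl _ _ _ _ ⟩
    (eval k p t + h * eval (suc k) ps x) * eval (suc k) qs x ∎
    where
    h = Vector.head x
    t = Vector.tail x

    eval-map : ∀ qs → eval (suc k) (List.map (mulᴾ k p) qs) x ≈ eval k p t * eval (suc k) qs x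
    eval-map [] = sym (zeroʳ _)
    eval-map (q ∷ qs) = trans (+-cong (eval-mul k p q t) (*-congˡ (eval-map qs)))
      (solve 4 (λ a b h c → a :* b :+ h :* (a :* c) := a :* (b :+ h :* c)) refl _ _ _ _)

  ι-−1 : ι (ℚ.- 1ℚ) ≈ - 1#
  ι-−1 = trans (ι.-‿homo 1ℚ) (-‿cong ι.1#-homo)

  eval-neg : ∀ k P x → eval k (negᴾ k P) x ≈ - eval k P x
  eval-neg k P x = begin
    eval k (negᴾ k P) x                          ≈⟨ eval-mul k (constᴾ k (ℚ.- 1ℚ)) P x ⟩
    eval k (constᴾ k (ℚ.- 1ℚ)) x * eval k P x    ≈⟨ *-congʳ (trans (eval-const k _ x) ι-−1) ⟩
    (- 1#) * eval k P x  ≈⟨ solve 1 (λ a → (:- con 1ℚ) :* a := :- a) refl _ ⟩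
    - eval k P x ∎

  eval-var : ∀ {k} (i : Fin k) x → eval k (varᴾ i) x ≈ x i
  eval-var {suc k} zero x = begin
    eval k (constᴾ k 0ℚ) t + h * (eval k (constᴾ k 1ℚ) t + h * 0#)
      ≈⟨ +-cong (trans (eval-const k 0ℚ t) ι.0#-homo)
           (*-congˡ (+-congʳ (trans (eval-const k 1ℚ t) ι.1#-homo))) ⟩
    0# + h * (1# + h * 0#)
      ≈⟨ solve 1 (λ h → con 0ℚ :+ h :* (con 1ℚ :+ h :* con 0ℚ) := h) refl h ⟩
    h ∎
    where
    h = Vector.head x
    t = Vector.tail x
  eval-var {suc k} (suc i) x = begin
    eval k (varᴾ i) (Vector.tail x) + Vector.head x * 0#
      ≈⟨ +-cong (eval-var i (Vector.tail x)) (zeroʳ (Vector.head x)) ⟩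
    x (suc i) + 0#   ≈⟨ +-identityʳ (x (suc i)) ⟩
    x (suc i)        ∎

  isZero⇒eval≈0 : ∀ k {P} → IsZero k P → ∀ x → eval k P x ≈ 0#
  isZero⇒eval≈0 zero    ≡.refl x = ι.0#-homo
  isZero⇒eval≈0 (suc k) []       x = refl
  isZero⇒eval≈0 (suc k) {p ∷ ps} (z ∷ zs) x = begin
    eval k p (Vector.tail x) + Vector.head x * eval (suc k) ps x
      ≈⟨ +-cong (isZero⇒eval≈0 k z (Vector.tail x)) (*-congˡ (isZero⇒eval≈0 (suc k) zs x)) ⟩
    0# + Vector.head x * 0#   ≈⟨ +-identityˡ _ ⟩
    Vector.head x * 0#        ≈⟨ zeroʳ _ ⟩
    0#                        ∎

-- The operations on Poly k, seen as polynomial evaluation, so that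
-- substitution of polynomials into polynomials is an instance of eval.
polyRawRing : ℕ → RawRing 0ℓ 0ℓ
polyRawRing k = record
  { Carrier = Poly k ; _≈_ = _≡_ ; _+_ = addᴾ k ; _*_ = mulᴾ k ; -_ = negᴾ k
  ; 0# = constᴾ k 0ℚ ; 1# = constᴾ k 1ℚ }

-- `A` is only a raw ring, since coefficient lists under `_≡_` do not form a ring: trailing zeros
-- spoil the inverse law. Naturality of `eval` rests on these four equations alone.
record IsEvaluationHom (A : RawRing 0ℓ 0ℓ) (κ : ℚ → RawRing.Carrier A) (R : ℚAlgebra)
  (h : RawRing.Carrier A → ℚAlgebra.Carrier R) : Set where
  private
    module A = RawRing A
  open ℚAlgebra R
  field
    +-homo : ∀ a b → h (a A.+ b) ≈ h a + h b
    *-homo : ∀ a b → h (a A.* b) ≈ h a * h b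
    0-homo : h A.0# ≈ 0#
    ι-homo : ∀ q → h (κ q) ≈ ι q

  eval-natural : ∀ k P {x y} → (∀ i → h (x i) ≈ y i) →
    h (Over.eval A κ k P x) ≈ Over.eval rawRing ι k P y
  eval-natural zero    q hx = ι-homo q
  eval-natural (suc k) [] hx = 0-homo
  eval-natural (suc k) (p ∷ ps) hx = trans (+-homo _ _) (+-cong
    (eval-natural k p (hx ∘ suc))
    (trans (*-homo _ _) (*-cong (hx zero) (eval-natural (suc k) ps hx))))

module _ (R : ℚAlgebra) where
  open ℚAlgebra R
  open Evaluation R

  id-isEvaluationHom : IsEvaluationHom rawRing ι R id
  id-isEvaluationHom = record
    { +-homo = λ _ _ → refl ; *-homo = λ _ _ → refl ; 0-homo = refl ; ι-homo = λ _ → refl }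

  eval-cong : ∀ k P {x y} → (∀ i → x i ≈ y i) → eval k P x ≈ eval k P y
  eval-cong = IsEvaluationHom.eval-natural id-isEvaluationHom

  eval-isEvaluationHom : ∀ k x → IsEvaluationHom (polyRawRing k) (constᴾ k) R (λ P → eval k P x)
  eval-isEvaluationHom k x = record
    { +-homo = λ P Q → eval-add k P Q x
    ; *-homo = λ P Q → eval-mul k P Q x
    ; 0-homo = trans (eval-const k 0ℚ x) ι.0#-homo
    ; ι-homo = λ q → eval-const k q x
    }

-- Double negation, and integral domains with stable equality

infixl 1 _>>=_

¬¬-η : ∀ {a} {A : Set a} → A → ¬ ¬ A
¬¬-η a ¬a = ¬a a

_>>=_ : ∀ {a b} {A : Set a} {B : Set b} → ¬ ¬ A → (A → ¬ ¬ B) → ¬ ¬ B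
(m >>= f) ¬b = m λ a → f a ¬b

¬¬-em : ∀ {a} (A : Set a) → ¬ ¬ (A ⊎ ¬ A)
¬¬-em A k = k (inj₂ λ a → k (inj₁ a))

¬¬-finite : ∀ {p} n {P : Fin n → Set p} → (∀ i → ¬ ¬ P i) → ¬ ¬ (∀ i → P i)
¬¬-finite zero    f k = k λ ()
¬¬-finite (suc n) f = f zero >>= λ p₀ → ¬¬-finite n (f ∘ suc) >>= λ p₊ →
  ¬¬-η λ { zero → p₀ ; (suc i) → p₊ i }

-- Nonzero means negated equality; with `stable` and `*-cancel` this replaces apartness and
-- inverses. `ι-injective` is characteristic zero: it excludes the zero ring and lets 2 and the
-- exponents brought down by differentiation be cancelled.
record Domain : Set₁ where
  field
    algebra : ℚAlgebra
  open ℚAlgebra algebra public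
  field
    stable      : ∀ {x y} → ¬ ¬ (x ≈ y) → x ≈ y
    *-cancel    : ∀ {x y} → ¬ (x ≈ 0#) → x * y ≈ 0# → y ≈ 0#
    ι-injective : ∀ {q} → ι q ≈ 0# → q ≡ 0ℚ

  *-≉0 : ∀ {x y} → ¬ (x ≈ 0#) → ¬ (y ≈ 0#) → ¬ (x * y ≈ 0#)
  *-≉0 x≉0 y≉0 xy≈0 = y≉0 (*-cancel x≉0 xy≈0)

  1≉0 : ¬ (1# ≈ 0#)
  1≉0 1≈0 with ι-injective (trans ι.1#-homo 1≈0)
  ... | ()

-- Dual numbers

module _ (R : ℚAlgebra) where
  open ℚAlgebra R
  open Solver

  -- R[ε] with ε² = 0. Evaluation at x + ε δ yields the value and the directional derivative of a
  -- polynomial at once, so formal partial derivatives never have to be defined.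
  dual : ℚAlgebra
  dual = record
    { commutativeRing = record
      { Carrier = Carrier × Carrier
      ; _≈_ = λ x y → (proj₁ x ≈ proj₁ y) × (proj₂ x ≈ proj₂ y)
      ; _+_ = λ x y → proj₁ x + proj₁ y , proj₂ x + proj₂ y
      ; _*_ = λ x y → proj₁ x * proj₁ y , proj₁ x * proj₂ y + proj₂ x * proj₁ y
      ; -_  = λ x → - proj₁ x , - proj₂ x
      ; 0#  = 0# , 0#
      ; 1#  = 1# , 0#
      ; isCommutativeRing = record
        { isRing = record
          { +-isAbelianGroup = record
            { isGroup = record
              { isMonoid = record
                { isSemigroup = record
                  { isMagma = record
                    { isEquivalence = record
                      { refl  = refl , refl
                      ; sym   = λ (p , q) → sym p , sym q
                      ; trans = λ (p , q) (r , s) → trans p r , trans q s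
                      }
                    ; ∙-cong = λ (p , q) (r , s) → +-cong p r , +-cong q s
                    }
                  ; assoc = λ x y z → +-assoc _ _ _ , +-assoc _ _ _
                  }
                ; identity = (λ x → +-identityˡ _ , +-identityˡ _)
                           , (λ x → +-identityʳ _ , +-identityʳ _)
                }
              ; inverse = (λ x → -‿inverseˡ _ , -‿inverseˡ _)
                        , (λ x → -‿inverseʳ _ , -‿inverseʳ _)
              ; ⁻¹-cong = λ (p , q) → -‿cong p , -‿cong q
              }
            ; comm = λ x y → +-comm _ _ , +-comm _ _
            }
          ; *-cong = λ (p , q) (r , s) →
              *-cong p r , +-cong (*-cong p s) (*-cong q r)
          ; *-assoc = λ x y z → *-assoc _ _ _ ,
              solve 6 (λ a a′ b b′ c c′ → (a :* b) :* c′ :+ (a :* b′ :+ a′ :* b) :* c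
                := a :* (b :* c′ :+ b′ :* c) :+ a′ :* (b :* c)) refl _ _ _ _ _ _
          ; *-identity =
              (λ x → *-identityˡ _ ,
                solve 2 (λ a a′ → con 1ℚ :* a′ :+ con 0ℚ :* a := a′) refl _ _)
            , (λ x → *-identityʳ _ ,
                solve 2 (λ a a′ → a :* con 0ℚ :+ a′ :* con 1ℚ := a′) refl _ _)
          ; distrib =
              (λ x y z → distribˡ _ _ _ ,
                solve 6 (λ a a′ b b′ c c′ → a :* (b′ :+ c′) :+ a′ :* (b :+ c)
                  := (a :* b′ :+ a′ :* b) :+ (a :* c′ :+ a′ :* c)) refl _ _ _ _ _ _)
            , (λ x y z → distribʳ _ _ _ ,
                solve 6 (λ a a′ b b′ c c′ → (b :+ c) :* a′ :+ (b′ :+ c′) :* a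
                  := (b :* a′ :+ b′ :* a) :+ (c :* a′ :+ c′ :* a)) refl _ _ _ _ _ _)
          }
        ; *-comm = λ x y → *-comm _ _ ,
            solve 4 (λ a a′ b b′ → a :* b′ :+ a′ :* b := b :* a′ :+ b′ :* a) refl _ _ _ _
        }
      }
    ; ι = λ q → ι q , 0#
    ; ι-hom = record
      { isSemiringHomomorphism = record
        { isNearSemiringHomomorphism = record
          { +-isMonoidHomomorphism = record
            { isMagmaHomomorphism = record
              { isRelHomomorphism = record { cong = λ { ≡.refl → refl , refl } }
              ; homo = λ p q → ι.+-homo p q , sym (+-identityˡ _)
              }
            ; ε-homo = ι.0#-homo , refl
            }
          ; *-homo = λ p q → ι.*-homo p q ,
              solve 2 (λ a b → con 0ℚ := a :* con 0ℚ :+ con 0ℚ :* b) refl _ _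
          }
        ; 1#-homo = ι.1#-homo , refl
        }
      ; -‿homo = λ p → ι.-‿homo p , sym -0#≈0#
      }
    }

-- Extending derivations

fromℕ : ℕ → ℚ
fromℕ zero    = 0ℚ
fromℕ (suc n) = 1ℚ ℚ.+ fromℕ n

fromℕ-nonNeg : ∀ n → 0ℚ ℚ.≤ fromℕ n
fromℕ-nonNeg zero    = ℚ.≤-refl
fromℕ-nonNeg (suc n) = ℚ.+-mono-≤ (ℚ.nonNegative⁻¹ 1ℚ) (fromℕ-nonNeg n)

fromℕ-suc≢0 : ∀ n → ¬ (fromℕ (suc n) ≡ 0ℚ)
fromℕ-suc≢0 n eq = ℚ.<⇒≢ (ℚ.+-mono-<-≤ (ℚ.positive⁻¹ 1ℚ) (fromℕ-nonNeg n)) (≡.sym eq)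

module Tangents (K : Domain) where
  open Domain K
  open Over rawRing ι using (eval; AlgebraicallyIndependent)
  private
    module E  = ℚAlgebra (dual algebra)
    module EE = Evaluation (dual algebra)

  evalᴱ : ∀ k → Poly k → Vector E.Carrier k → E.Carrier
  evalᴱ = Over.eval E.rawRing E.ι

  -- X = x + ε δ is a point of the tangent bundle of the variety of which
  -- x is a generic point over ℚ.
  Tangent : ∀ {k} → Vector E.Carrier k → Set
  Tangent {k} X = ∀ P → proj₁ (evalᴱ k P X) ≈ 0# → proj₂ (evalᴱ k P X) ≈ 0#

  scale₂ : Carrier → E.Carrier → E.Carrier
  scale₂ l (a , b) = a , l * b

  proj₁-isEvaluationHom : IsEvaluationHom E.rawRing E.ι algebra proj₁
  proj₁-isEvaluationHom = record
    { +-homo = λ _ _ → refl ; *-homo = λ _ _ → refl ; 0-homo = refl ; ι-homo = λ _ → refl }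

  -- Replacing ε by l ε respects products because l ε squares to zero as well.
  scale₂-isEvaluationHom : ∀ l → IsEvaluationHom E.rawRing E.ι (dual algebra) (scale₂ l)
  scale₂-isEvaluationHom l = record
    { +-homo = λ _ _ → refl , distribˡ l _ _
    ; *-homo = λ _ _ → refl ,
        solve 5 (λ l a a′ b b′ → l :* (a :* b′ :+ a′ :* b) := a :* (l :* b′) :+ (l :* a′) :* b)
          refl l _ _ _ _
    ; 0-homo = refl , zeroʳ l
    ; ι-homo = λ _ → refl , zeroʳ l
    }
    where open Solver

  proj₁-eval : ∀ k P X → proj₁ (evalᴱ k P X) ≈ eval k P (proj₁ ∘ X)
  proj₁-eval k P X = IsEvaluationHom.eval-natural proj₁-isEvaluationHom k P (λ _ → refl)

  -- Only zero polynomials vanish at an algebraically independent point, so tangency does not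
  -- constrain the velocity there. This is what allows the velocity of `p` to be prescribed.
  generic⇒tangent : ∀ {k} {X : Vector E.Carrier k} →
    AlgebraicallyIndependent (proj₁ ∘ X) → Tangent X
  generic⇒tangent {k} {X} gen P P≈0 = proj₂ (EE.isZero⇒eval≈0 k
    (gen P (trans (sym (proj₁-eval k P X)) P≈0)) X)

  module Extension {k} (X : Vector E.Carrier k) (tangent : Tangent X) (z : Carrier) where

    -- `D` is a derivation along the evaluation `φ`; by `tangent` it kills the kernel of `φ` and so
    -- descends to the subring ℚ[x].
    φ D : Poly k → Carrier
    φ P = proj₁ (evalᴱ k P X)
    D P = proj₂ (evalᴱ k P X)

    pow dpow : ℕ → Carrier
    pow zero    = 1#
    pow (suc n) = z * pow n

    dpow zero    = 0#
    dpow (suc n) = pow n + z * dpow n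

    dpow-suc : ∀ n → dpow (suc n) ≈ ι (fromℕ (suc n)) * pow n
    dpow-suc zero = trans (solve 1 (λ z → con 1ℚ :+ z :* con 0ℚ := con 1ℚ) refl z)
      (trans (sym (*-identityʳ 1#)) (*-congʳ (sym ι.1#-homo)))
      where open Solver
    dpow-suc (suc n) = begin
      z * pow n + z * dpow (suc n)                        ≈⟨ +-congˡ (*-congˡ (dpow-suc n)) ⟩
      z * pow n + z * (ι (fromℕ (suc n)) * pow n)
        ≈⟨ solve 3 (λ z p c → z :* p :+ z :* (c :* p) := (con 1ℚ :+ c) :* (z :* p)) refl _ _ _ ⟩
      (1# + ι (fromℕ (suc n))) * (z * pow n)
        ≈⟨ *-congʳ (trans (+-congʳ (sym ι.1#-homo)) (sym (ι.+-homo 1ℚ _))) ⟩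
      ι (fromℕ (suc (suc n))) * (z * pow n)               ∎
      where open Solver

    -- Vec (Poly k) n lists the coefficients of a polynomial of degree < n in
    -- one further variable, leading coefficient first.
    value coefficientDerivative derivative : ∀ {n} → Vec (Poly k) n → Carrier
    value [] = 0#
    value {suc n} (a ∷ as) = value as + φ a * pow n

    coefficientDerivative [] = 0#
    coefficientDerivative {suc n} (a ∷ as) = coefficientDerivative as + D a * pow n

    derivative [] = 0#
    derivative {suc n} (a ∷ as) = derivative as + φ a * dpow n

    differentiate : ∀ {n} → Vec (Poly k) (suc n) → Vec (Poly k) n
    differentiate {zero}  (a ∷ []) = []
    differentiate {suc n} (a ∷ as) = mulᴾ k (constᴾ k (fromℕ (suc n))) a ∷ differentiate as

    φ-mul-const : ∀ q a → φ (mulᴾ k (constᴾ k q) a) ≈ ι q * φ a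
    φ-mul-const q a = trans (proj₁ (EE.eval-mul k (constᴾ k q) a X))
                            (*-congʳ (proj₁ (EE.eval-const k q X)))

    derivative-differentiate : ∀ {n} (as : Vec (Poly k) (suc n)) →
      derivative as ≈ value (differentiate as)
    derivative-differentiate {zero} (a ∷ []) = trans (+-identityˡ _) (zeroʳ _)
    derivative-differentiate {suc n} (a ∷ as) = +-cong (derivative-differentiate as) (begin
      φ a * dpow (suc n)                  ≈⟨ *-congˡ (dpow-suc n) ⟩
      φ a * (ι (fromℕ (suc n)) * pow n)
        ≈⟨ solve 3 (λ a c p → a :* (c :* p) := (c :* a) :* p) refl _ _ _ ⟩
      (ι (fromℕ (suc n)) * φ a) * pow n   ≈⟨ *-congʳ (sym (φ-mul-const _ a)) ⟩
      φ (mulᴾ k (constᴾ k (fromℕ (suc n))) a) * pow n ∎)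
      where open Solver

    Zeros : ∀ {n} → Vec (Poly k) n → Set
    Zeros = VecAll.All (λ a → φ a ≈ 0#)

    zeros-stable : ∀ {n} (as : Vec (Poly k) n) → ¬ ¬ Zeros as → Zeros as
    zeros-stable []       _  = []
    zeros-stable (a ∷ as) nn = stable (nn >>= λ zs → ¬¬-η (VecAll.head zs))
                             ∷ zeros-stable as (nn >>= λ zs → ¬¬-η (VecAll.tail zs))

    -- Linear independence of 1, z, ..., zⁿ⁻¹ over ℚ[x]; for all n together, transcendence of z.
    Free : ℕ → Set
    Free n = (as : Vec (Poly k) n) → value as ≈ 0# → Zeros as

    free-stable : ∀ n → ¬ ¬ Free n → Free n
    free-stable n nn as eq = zeros-stable as (nn >>= λ free → ¬¬-η (free as eq))

    -- Together with `Free n`, a minimal polynomial of z of degree n, not made monic.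
    record Relation (n : ℕ) : Set where
      field
        leading   : Poly k
        lower     : Vec (Poly k) n
        leading≉0 : ¬ (φ leading ≈ 0#)
        value≈0   : value (leading ∷ lower) ≈ 0#

    relation : ∀ n → Free n → ¬ Free (suc n) → ¬ ¬ Relation n
    relation n free ¬free k = ¬free λ where
      (a ∷ as) eq →
        let a≈0 = stable λ a≉0 → k (record
                    { leading = a ; lower = as ; leading≉0 = a≉0 ; value≈0 = eq })
        in a≈0 ∷ free as (begin
             value as                ≈⟨ +-identityʳ _ ⟨
             value as + 0#           ≈⟨ +-congˡ (zeroˡ _) ⟨
             value as + 0# * pow n   ≈⟨ +-congˡ (*-congʳ a≈0) ⟨
             value as + φ a * pow n  ≈⟨ eq ⟩
             0#                      ∎)

    -- A least-degree argument that decides nothing: if the second alternative is refuted, every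
    -- `Free n` follows by induction, because a first failure would supply that alternative;
    -- `free-stable` removes the double negation at each stage.
    dichotomy : ¬ ¬ ((∀ n → Free n) ⊎ ∃ λ n → Free n × Relation n)
    dichotomy k = k (inj₁ free)
      where
      free : ∀ n → Free n
      free zero    []  _ = []
      free (suc n) = free-stable (suc n) λ ¬free →
        relation n (free n) ¬free λ r → k (inj₂ (n , free n , r))

    -- Separability in characteristic zero. The derivative of a minimal relation has smaller degree
    -- and leading coefficient a positive integer times a nonzero value, so by minimality it cannot
    -- vanish at z.
    derivative≉0 : ∀ {n} → Free n → (r : Relation n) →
      ¬ (derivative (Relation.leading r ∷ Relation.lower r) ≈ 0#)
    -- A relation of degree 0 is a nonzero constant equal to 0, a contradiction by itself.
    derivative≉0 {zero} free r eq with Relation.lower r | Relation.value≈0 r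
    ... | [] | v≈0 = Relation.leading≉0 r
      (trans (solve 1 (λ a → a := con 0ℚ :+ a :* con 1ℚ) refl _) v≈0)
      where open Solver
    derivative≉0 {suc n} free r eq = Relation.leading≉0 r (*-cancel
      (fromℕ-suc≢0 n ∘ ι-injective)
      (trans (sym (φ-mul-const _ _)) (VecAll.head (free (differentiate (leading ∷ lower))
        (trans (sym (derivative-differentiate (leading ∷ lower))) eq)))))
      where open Relation r

    module _ (l z′ : Carrier) where
      Z : E.Carrier
      Z = z , z′

      X′ : Vector E.Carrier k
      X′ = scale₂ l ∘ X

      Φ : Poly k → E.Carrier
      Φ P = evalᴱ k P X′

      Φ≈scale₂ : ∀ P → Φ P E.≈ scale₂ l (φ P , D P)
      Φ≈scale₂ P = E.sym (IsEvaluationHom.eval-natural (scale₂-isEvaluationHom l) k P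
        (λ _ → E.refl))

      powᴱ : ℕ → E.Carrier
      powᴱ zero    = E.1#
      powᴱ (suc n) = Z E.* powᴱ n

      powᴱ≈ : ∀ n → powᴱ n E.≈ (pow n , z′ * dpow n)
      powᴱ≈ zero    = refl , sym (zeroʳ z′)
      powᴱ≈ (suc n) = E.trans (E.*-congˡ {Z} (powᴱ≈ n)) (refl ,
        solve 4 (λ z z′ p d → z :* (z′ :* d) :+ z′ :* p := z′ :* (p :+ z :* d)) refl _ _ _ _)
        where open Solver

      valueᴱ : ∀ {n} → Vec (Poly k) n → E.Carrier
      valueᴱ [] = E.0#
      valueᴱ {suc n} (a ∷ as) = valueᴱ as E.+ Φ a E.* powᴱ n

      -- The chain rule: the ε-part consists of the derivatives of the coefficients, scaled by `l`,
      -- and of `z′` times the derivative in the new variable.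
      valueᴱ≈ : ∀ {n} (as : Vec (Poly k) n) →
        valueᴱ as E.≈ (value as , l * coefficientDerivative as + z′ * derivative as)
      valueᴱ≈ [] = refl , solve 2 (λ l z′ → con 0ℚ := l :* con 0ℚ :+ z′ :* con 0ℚ) refl _ _
        where open Solver
      valueᴱ≈ {suc n} (a ∷ as) =
        E.trans (E.+-cong (valueᴱ≈ as) (E.*-cong (Φ≈scale₂ a) (powᴱ≈ n))) (refl ,
        solve 8 (λ l z′ c d f f′ p p′ →
            (l :* c :+ z′ :* d) :+ (f :* (z′ :* p′) :+ (l :* f′) :* p)
            := l :* (c :+ f′ :* p) :+ z′ :* (d :+ f :* p′)) refl _ _ _ _ _ _ _ _)
        where open Solver

      zeros⇒valueᴱ≈0 : ∀ {n} {as : Vec (Poly k) n} → Zeros as → valueᴱ as E.≈ E.0#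
      zeros⇒valueᴱ≈0 [] = E.refl
      zeros⇒valueᴱ≈0 {suc n} {a ∷ as} (a≈0 ∷ zs) = E.trans
        (E.+-cong (zeros⇒valueᴱ≈0 zs) (E.*-congʳ {powᴱ n}
          (E.trans (Φ≈scale₂ a) (a≈0 , trans (*-congˡ (tangent a a≈0)) (zeroʳ l)))))
        (E.trans (E.+-identityˡ (E.0# E.* powᴱ n)) (E.zeroˡ (powᴱ n)))

      free⇒valueᴱ≈0 : ∀ {n} → Free n → (as : Vec (Poly k) n) →
        proj₁ (valueᴱ as) ≈ 0# → valueᴱ as E.≈ E.0#
      free⇒valueᴱ≈0 free as eq =
        zeros⇒valueᴱ≈0 (free as (trans (sym (proj₁ (valueᴱ≈ as))) eq))

      evalᴱ-suc : Poly (suc k) → E.Carrier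
      evalᴱ-suc Q = evalᴱ (suc k) Q (Z Vector.∷ X′)

      -- Horner's step. It reconciles the constant-first lists of `Poly` with the leading-first
      -- vectors in which minimality is expressed.
      valueᴱ-∷ʳ : ∀ {n} (as : Vec (Poly k) n) q →
        valueᴱ (as ∷ʳ q) E.≈ Φ q E.+ Z E.* valueᴱ as
      valueᴱ-∷ʳ [] q = solve 2 (λ z q → con 0ℚ :+ q :* con 1ℚ := q :+ z :* con 0ℚ) E.refl Z (Φ q)
        where open E.Solver
      valueᴱ-∷ʳ {suc n} (a ∷ as) q =
        E.trans (E.+-congʳ {Φ a E.* powᴱ (suc n)} (valueᴱ-∷ʳ as q))
        (solve 5 (λ q z s a p → (q :+ z :* s) :+ a :* (z :* p) := q :+ z :* (s :+ a :* p)) E.refl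
          (Φ q) Z (valueᴱ as) (Φ a) (powᴱ n))
        where open E.Solver

      linearCombination : ∀ {n} → Poly k → Vec (Poly k) n → Poly k → Vec (Poly k) n → Vec (Poly k) n
      linearCombination c as d bs = Vec.zipWith (λ a b → addᴾ k (mulᴾ k c a) (mulᴾ k d b)) as bs

      Φ-combine : ∀ c a d b →
        Φ (addᴾ k (mulᴾ k c a) (mulᴾ k d b)) E.≈ (Φ c E.* Φ a) E.+ (Φ d E.* Φ b)
      Φ-combine c a d b = E.trans (EE.eval-add k (mulᴾ k c a) (mulᴾ k d b) X′)
        (E.+-cong (EE.eval-mul k c a X′) (EE.eval-mul k d b X′))

      valueᴱ-combine : ∀ {n} c (as : Vec (Poly k) n) d bs →
        valueᴱ (linearCombination c as d bs) E.≈ (Φ c E.* valueᴱ as) E.+ (Φ d E.* valueᴱ bs)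
      valueᴱ-combine c [] d [] =
        solve 2 (λ c d → con 0ℚ := c :* con 0ℚ :+ d :* con 0ℚ) E.refl (Φ c) (Φ d)
        where open E.Solver
      valueᴱ-combine {suc n} c (a ∷ as) d (b ∷ bs) = E.trans
        (E.+-cong (valueᴱ-combine c as d bs) (E.*-congʳ {powᴱ n} (Φ-combine c a d b)))
        (solve 7 (λ c s d t a b p → (c :* s :+ d :* t) :+ (c :* a :+ d :* b) :* p
            := c :* (s :+ a :* p) :+ d :* (t :+ b :* p)) E.refl
          (Φ c) (valueᴱ as) (Φ d) (valueᴱ bs) (Φ a) (Φ b) (powᴱ n))
        where open E.Solver

      expand : ∀ Q → ∃ λ n → Σ (Vec (Poly k) n) λ as → evalᴱ-suc Q E.≈ valueᴱ as
      expand [] = 0 , [] , E.refl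
      expand (q ∷ Q) with expand Q
      ... | n , as , eq = suc n , as ∷ʳ q , E.trans
        (E.+-congˡ {Φ q} (E.*-congˡ {Z} eq)) (E.sym (valueᴱ-∷ʳ as q))

      transcendental : (∀ n → Free n) → Tangent (Z Vector.∷ X′)
      transcendental free Q eq with expand Q
      ... | n , as , eq′ = proj₂ (E.trans eq′
        (free⇒valueᴱ≈0 (free n) as (trans (sym (proj₁ eq′)) eq)))

      module Division {n} (r : Relation n)
        (valueᴱ≈0 : valueᴱ (Relation.leading r ∷ Relation.lower r) E.≈ E.0#) where
        open Relation r

        -- Subtracting `a` times the relation from `leading` times the polynomial cancels the term
        -- of degree n.
        reduce : (as : Vec (Poly k) (suc n)) →
          Σ (Vec (Poly k) n) λ bs → Φ leading E.* valueᴱ as E.≈ valueᴱ bs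
        reduce (a ∷ as) = linearCombination leading as (negᴾ k a) lower , E.sym (E.trans
          (valueᴱ-combine leading as (negᴾ k a) lower)
          (E.trans (E.+-congˡ {Φ leading E.* valueᴱ as}
                     (E.*-congʳ {valueᴱ lower} (EE.eval-neg k a X′)))
          -- The multiple `Φ a` of the relation is zero over the dual numbers too; adding it back
          -- leaves a plain ring identity.
          (E.trans (E.sym (E.+-identityʳ rhs))
          (E.trans (E.+-congˡ {rhs} (E.sym (E.zeroʳ (Φ a))))
          (E.trans (E.+-congˡ {rhs} (E.*-congˡ {Φ a} (E.sym valueᴱ≈0)))
          (solve 5 (λ c s a t p → (c :* s :+ (:- a) :* t) :+ a :* (t :+ c :* p)
              := c :* (s :+ a :* p)) E.refl
            (Φ leading) (valueᴱ as) (Φ a) (valueᴱ lower) (powᴱ n)))))))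
          where
          open E.Solver
          rhs : E.Carrier
          rhs = (Φ leading E.* valueᴱ as) E.+ ((E.- Φ a) E.* valueᴱ lower)

        -- Pseudo-division by the relation r.
        divide : ∀ Q → Σ (Poly k) λ c → ¬ (φ c ≈ 0#) ×
          Σ (Vec (Poly k) n) λ as → Φ c E.* evalᴱ-suc Q E.≈ valueᴱ as
        divide [] = constᴾ k 1ℚ
          , (λ eq → 1≉0 (trans (sym (trans (proj₁ (EE.eval-const k 1ℚ X)) ι.1#-homo)) eq))
          , Vec.replicate n (constᴾ k 0ℚ)
          , E.trans (E.zeroʳ (Φ (constᴾ k 1ℚ))) (E.sym (zeros⇒valueᴱ≈0 (zeros n)))
          where
          zeros : ∀ n → Zeros (Vec.replicate n (constᴾ k 0ℚ))
          zeros zero    = []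
          zeros (suc n) = trans (proj₁ (EE.eval-const k 0ℚ X)) ι.0#-homo ∷ zeros n
        divide (q ∷ Q) with divide Q
        ... | c , c≉0 , as , eq with reduce (as ∷ʳ mulᴾ k c q)
        ... | bs , eq′ = mulᴾ k leading c
          , (λ lc≈0 → *-≉0 leading≉0 c≉0
              (trans (sym (proj₁ (EE.eval-mul k leading c X))) lc≈0))
          , bs
          , E.trans (E.*-congʳ {evalᴱ-suc (q ∷ Q)} (EE.eval-mul k leading c X′))
            (E.trans (solve 5 (λ l c q z w →
                 (l :* c) :* (q :+ z :* w) := l :* (c :* q :+ z :* (c :* w))) E.refl
               (Φ leading) (Φ c) (Φ q) Z (evalᴱ-suc Q))
            (E.trans (E.*-congˡ {Φ leading} (E.trans
               (E.+-cong (E.sym (EE.eval-mul k c q X′)) (E.*-congˡ {Z} eq))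
               (E.sym (valueᴱ-∷ʳ as (mulᴾ k c q)))))
             eq′))
          where open E.Solver

        -- If Q vanishes at z, so does its pseudo-remainder, whose degree is below n; by minimality
        -- its coefficients vanish, hence so does its ε-part. The product rule then leaves the
        -- nonzero φ c times the ε-part of Q equal to 0.
        algebraic : Free n → Tangent (Z Vector.∷ X′)
        algebraic free Q eq with divide Q
        ... | c , c≉0 , as , eq′ = *-cancel c≉0 (begin
          φ c * proj₂ w                       ≈⟨ +-identityʳ _ ⟨
          φ c * proj₂ w + 0#                  ≈⟨ +-congˡ (zeroʳ _) ⟨
          φ c * proj₂ w + proj₂ (Φ c) * 0#
            ≈⟨ +-cong (*-congʳ (proj₁ (Φ≈scale₂ c))) (*-congˡ eq) ⟨
          proj₂ (Φ c E.* w)                   ≈⟨ proj₂ eq′ ⟩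
          proj₂ (valueᴱ as)                   ≈⟨ proj₂ (free⇒valueᴱ≈0 free as value≈) ⟩
          0#                                  ∎)
          where
          w : E.Carrier
          w = evalᴱ-suc Q

          value≈ : proj₁ (valueᴱ as) ≈ 0#
          value≈ = trans (sym (proj₁ eq′)) (trans (*-congˡ eq) (zeroʳ _))

    extend : ¬ ¬ ∃ λ l → ¬ (l ≈ 0#) × ∃ λ z′ → Tangent ((z , z′) Vector.∷ (scale₂ l ∘ X))
    extend = dichotomy >>= λ where
      -- Any velocity of a transcendental z would do; 0 is chosen.
      (inj₁ free) → ¬¬-η (1# , 1≉0 , 0# , transcendental 1# 0# free)
      (inj₂ (n , free , r)) →
        let open Solver
            as = Relation.leading r ∷ Relation.lower r
            -- Implicit differentiation asks for minus `coefficientDerivative` over `derivative`;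
            -- the denominator is moved into `l`.
            l  = derivative as
            z′ = - coefficientDerivative as
        in ¬¬-η (l , derivative≉0 free r , z′ ,
             Division.algebraic l z′ r (E.trans (valueᴱ≈ l z′ as) (Relation.value≈0 r ,
               solve 2 (λ l c → l :* c :+ (:- c) :* l := con 0ℚ) refl _ _)) free)

-- Linear algebra over an integral domain

module LinearAlgebra (K : Domain) where
  open Domain K

  ¬∀≈0⇒¬¬∃≉0 : ∀ {n} (f : Vector Carrier n) → ¬ (∀ i → f i ≈ 0#) → ¬ ¬ ∃ λ i → ¬ (f i ≈ 0#)
  ¬∀≈0⇒¬¬∃≉0 f ¬all k = ¬all λ i → stable λ fi≉0 → k (i , fi≉0)

  sum-zero : ∀ {n} {f : Vector Carrier n} → (∀ i → f i ≈ 0#) → sum f ≈ 0#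
  sum-zero {zero}  f≈0 = refl
  sum-zero {suc n} f≈0 = trans (+-cong (f≈0 zero) (sum-zero (f≈0 ∘ suc))) (+-identityˡ 0#)

  sum-single : ∀ {n} {f : Vector Carrier n} i → (∀ j → i ≢ j → f j ≈ 0#) → sum f ≈ f i
  sum-single {suc n} {f} i f≈0 = begin
    sum f                             ≈⟨ sum-remove {i = i} f ⟩
    f i + sum (f ∘ punchIn i)
      ≈⟨ +-congˡ (sum-zero λ j → f≈0 (punchIn i j) (Fin.punchInᵢ≢i i j ∘ ≡.sym)) ⟩
    f i + 0#                          ≈⟨ +-identityʳ (f i) ⟩
    f i                               ∎

  Dependent : ∀ {r m} → Vector (Vector Carrier m) r → Set
  Dependent {r} {m} v = ∃ λ (c : Vector Carrier r) → (∃ λ i → ¬ (c i ≈ 0#)) ×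
    (∀ j → sum (λ i → c i * v i j) ≈ 0#)

  -- Undoes a division-free elimination step with pivot `a` in row `p`: a dependence c of the
  -- cleared rows becomes one of the original rows, with coefficients c i * a off the pivot row. On
  -- the pivot row the coefficient is the one that makes column zero cancel.
  collect : ∀ {m} (c : Vector Carrier (suc m)) (v : Vector (Vector Carrier (suc m)) (suc (suc m))) p j → let w = v ∘ punchIn p ; a = v p zero in
    (∀ j → sum (λ i → c i * (a * w i (suc j) + - (w i zero * v p (suc j)))) ≈ 0#) →
    (- sum (λ i → c i * w i zero)) * v p j + sum (λ i → (c i * a) * w i j) ≈ 0#
  collect c v p zero eq = begin
    (- s) * a + sum (λ i → (c i * a) * w i zero)
      ≈⟨ +-congˡ (sum-cong-≋ {suc _} {λ i → (c i * a) * w i zero} {λ i → a * (c i * w i zero)}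
           λ i → trans (*-congʳ (*-comm _ _)) (*-assoc _ _ _)) ⟩
    (- s) * a + sum (λ i → a * (c i * w i zero))
      ≈⟨ +-congˡ (*-distribˡ-sum a (λ i → c i * w i zero)) ⟨
    (- s) * a + a * s
      ≈⟨ solve 2 (λ s a → (:- s) :* a :+ a :* s := con 0ℚ) refl s a ⟩
    0# ∎
    where
    open Solver
    w = v ∘ punchIn p
    a = v p zero
    s = sum (λ i → c i * w i zero)
  collect c v p (suc j) eq = begin
    (- s) * b + sum (λ i → (c i * a) * w i (suc j))
      ≈⟨ +-congʳ (solve 2 (λ s b → (:- s) :* b := (:- b) :* s) refl s b) ⟩
    (- b) * s + sum (λ i → (c i * a) * w i (suc j))
      ≈⟨ +-congʳ (*-distribˡ-sum (- b) (λ i → c i * w i zero)) ⟩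
    sum (λ i → (- b) * (c i * w i zero)) + sum (λ i → (c i * a) * w i (suc j))
      ≈⟨ ∑-distrib-+ (λ i → (- b) * (c i * w i zero)) (λ i → (c i * a) * w i (suc j)) ⟨
    sum (λ i → (- b) * (c i * w i zero) + (c i * a) * w i (suc j))
      ≈⟨ sum-cong-≋ (λ i → solve 5 (λ b c x a y →
           (:- b) :* (c :* x) :+ (c :* a) :* y := c :* (a :* y :+ :- (x :* b)))
           refl b (c i) (w i zero) a (w i (suc j))) ⟩
    sum (λ i → c i * (a * w i (suc j) + - (w i zero * b)))
      ≈⟨ eq j ⟩
    0# ∎
    where
    open Solver
    w = v ∘ punchIn p
    a = v p zero
    b = v p (suc j)
    s = sum (λ i → c i * w i zero)

  -- Induction on the number of coordinates, eliminating the first coordinate by a pivot if there is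
  -- one.
  dependent : ∀ {m} (v : Vector (Vector Carrier m) (suc m)) → ¬ ¬ Dependent v
  dependent {zero}  v = ¬¬-η ((λ _ → 1#) , (zero , 1≉0) , λ ())
  dependent {suc m} v = ¬¬-em (∃ λ i → ¬ (v i zero ≈ 0#)) >>= λ where
    -- Without a pivot the first coordinate is zero throughout; it is dropped along with one vector,
    -- which gets coefficient 0.
    (inj₂ none) → dependent (λ i j → v (suc i) (suc j)) >>= λ (c , (i , ci≉0) , eq) →
      ¬¬-η (0# Vector.∷ c , (suc i , ci≉0) , λ where
        zero → sum-zero {f = λ i → (0# Vector.∷ c) i * v i zero} λ i →
          trans (*-congˡ (stable λ v≉0 → none (i , v≉0))) (zeroʳ _)
        (suc j) → trans (+-cong (zeroˡ _) (eq j)) (+-identityˡ 0#))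
    (inj₁ (p , a≉0)) →
      let a = v p zero
          w = v ∘ punchIn p
          u = λ i j → a * w i (suc j) + - (w i zero * v p (suc j))
      in dependent u >>= λ (c , (i , ci≉0) , eq) →
      let c₀ = - sum (λ i → c i * w i zero)
          c′ = Vector.insertAt (λ i → c i * a) p c₀
          split : ∀ j → sum (λ i → c′ i * v i j) ≈
                    c₀ * v p j + sum (λ i → (c i * a) * w i j)
          split j = trans (sum-remove {i = p} (λ i → c′ i * v i j)) (+-cong
            (*-congʳ (reflexive (insertAt-lookup (λ i → c i * a) p c₀)))
            (sum-cong-≋ {suc m} {λ i → c′ (punchIn p i) * w i j} {λ i → (c i * a) * w i j}
              λ i → *-congʳ (reflexive (insertAt-punchIn (λ i → c i * a) p c₀ i))))
      in ¬¬-η (c′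
        , (punchIn p i , λ eq → *-≉0 ci≉0 a≉0 (trans
             (sym (reflexive (insertAt-punchIn (λ i → c i * a) p c₀ i))) eq))
        , λ j → trans (split j) (collect c v p j eq))

  unit : ∀ {m} → Fin m → Vector Carrier m
  unit j i = if does (j Fin.≟ i) then 1# else 0#

  record IsLinear {m} (ρ : Vector Carrier m → Carrier) : Set where
    field
      +-homo : ∀ x y → ρ (λ i → x i + y i) ≈ ρ x + ρ y
      *-homo : ∀ a x → ρ (λ i → a * x i) ≈ a * ρ x
      0-homo : ρ (λ _ → 0#) ≈ 0#

    sum-homo : ∀ {r} (c : Vector Carrier r) (xs : Vector (Vector Carrier m) r) →
      ρ (λ i → sum (λ b → c b * xs b i)) ≈ sum (λ b → c b * ρ (xs b))
    sum-homo {zero}  c xs = 0-homo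
    sum-homo {suc r} c xs = trans (+-homo _ _)
      (+-cong (*-homo _ _) (sum-homo (c ∘ suc) (xs ∘ suc)))

  -- `scalar` times the identity stands for the identity, so that no division occurs.
  record RightInverse {r m} (ρ : Vector (Vector Carrier m → Carrier) r) : Set where
    field
      scalar   : Carrier
      scalar≉0 : ¬ (scalar ≈ 0#)
      column   : Vector (Vector Carrier m) r
      diagonal : ∀ i → ρ i (column i) ≈ scalar
      off      : ∀ i j → i ≢ j → ρ i (column j) ≈ 0#

  -- Gaussian elimination one functional at a time. Positive data result in both cases, which can be
  -- evaluated at another point later, as a rank could not.
  rightInverse : ∀ {r m} (ρ : Vector (Vector Carrier m → Carrier) r) → (∀ i → IsLinear (ρ i)) →
    ¬ ¬ (Dependent (λ i j → ρ i (unit j)) ⊎ RightInverse ρ)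
  rightInverse {zero} ρ lin = ¬¬-η (inj₂ record
    { scalar = 1# ; scalar≉0 = 1≉0 ; column = λ () ; diagonal = λ () ; off = λ () })
  rightInverse {suc r} {m} ρ lin = rightInverse (ρ ∘ suc) (lin ∘ suc) >>= adjoin
    where
    ρ₀ = ρ zero
    module L i = IsLinear (lin i)
    open Solver

    module Step (inverse : RightInverse (ρ ∘ suc)) where
      open RightInverse inverse

      -- The value of `ρ₀` at `y j`, the unit vector j moved into the kernel of the other
      -- functionals. Read as a combination of rows, its vanishing for all j is a dependence with
      -- the nonzero coefficient `scalar` on `ρ₀`.
      κ : Vector Carrier m
      κ j = scalar * ρ₀ (unit j) + sum (λ b → (- ρ (suc b) (unit j)) * ρ₀ (column b))

      y : Fin m → Vector Carrier m
      y j i = scalar * unit j i + sum (λ b → (- ρ (suc b) (unit j)) * column b i)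

      ρ-y : ∀ a j → ρ a (y j) ≈
        scalar * ρ a (unit j) + sum (λ b → (- ρ (suc b) (unit j)) * ρ a (column b))
      ρ-y a j = trans (L.+-homo a _ _) (+-cong (L.*-homo a _ _)
        (L.sum-homo a (λ b → - ρ (suc b) (unit j)) column))

      ρ-suc-y : ∀ a j → ρ (suc a) (y j) ≈ 0#
      ρ-suc-y a j = begin
        ρ (suc a) (y j)  ≈⟨ ρ-y (suc a) j ⟩
        scalar * u + sum (λ b → (- ρ (suc b) (unit j)) * ρ (suc a) (column b))
          ≈⟨ +-congˡ (sum-single a λ b a≢b → trans (*-congˡ (off a b a≢b)) (zeroʳ _)) ⟩
        scalar * u + (- u) * ρ (suc a) (column a)
          ≈⟨ +-congˡ (*-congˡ (diagonal a)) ⟩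
        scalar * u + (- u) * scalar
          ≈⟨ solve 2 (λ s u → s :* u :+ (:- u) :* s := con 0ℚ) refl scalar u ⟩
        0# ∎
        where u = ρ (suc a) (unit j)

      extended : ∀ j → ¬ (κ j ≈ 0#) → RightInverse ρ
      extended j κ≉0 = record
        { scalar   = κ j * scalar
        ; scalar≉0 = *-≉0 κ≉0 scalar≉0
        ; column   = column′
        ; diagonal = diagonal′
        ; off      = off′
        }
        where
        column′ : Vector (Vector Carrier m) (suc r)
        column′ zero    i = scalar * y j i
        -- The multiple of `y j` makes `ρ₀` vanish, and the other functionals do not see it.
        column′ (suc b) i = κ j * column b i + (- ρ₀ (column b)) * y j i

        ρ-column′ : ∀ a b → ρ a (column′ (suc b)) ≈
          κ j * ρ a (column b) + (- ρ₀ (column b)) * ρ a (y j)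
        ρ-column′ a b = trans (L.+-homo a _ _) (+-cong (L.*-homo a _ _) (L.*-homo a _ _))

        diagonal′ : ∀ i → ρ i (column′ i) ≈ κ j * scalar
        diagonal′ zero = trans (L.*-homo zero _ _) (trans (*-congˡ (ρ-y zero j)) (*-comm _ _))
        diagonal′ (suc b) = trans (ρ-column′ (suc b) b) (trans
          (+-cong (*-congˡ (diagonal b)) (trans (*-congˡ (ρ-suc-y b j)) (zeroʳ _)))
          (+-identityʳ _))

        off′ : ∀ a b → a ≢ b → ρ a (column′ b) ≈ 0#
        off′ zero zero 0≢0 = ⊥-elim (0≢0 ≡.refl)
        off′ (suc a) zero _ = trans (L.*-homo (suc a) _ _)
          (trans (*-congˡ (ρ-suc-y a j)) (zeroʳ _))
        off′ zero (suc b) _ = trans (ρ-column′ zero b) (trans (+-congˡ (*-congˡ (ρ-y zero j)))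
          (solve 2 (λ k u → k :* u :+ (:- u) :* k := con 0ℚ) refl (κ j) (ρ₀ (column b))))
        off′ (suc a) (suc b) a≢b = trans (ρ-column′ (suc a) b) (trans
          (+-cong (trans (*-congˡ (off a b (a≢b ∘ ≡.cong suc))) (zeroʳ _))
                  (trans (*-congˡ (ρ-suc-y a j)) (zeroʳ _)))
          (+-identityʳ 0#))

      step : ¬ ¬ (Dependent (λ i j → ρ i (unit j)) ⊎ RightInverse ρ)
      step = ¬¬-em (∀ j → κ j ≈ 0#) >>= λ where
        (inj₁ κ≈0) → ¬¬-η (inj₁ (scalar Vector.∷ (λ b → - ρ₀ (column b)) , (zero , scalar≉0) ,
          λ j → trans (+-congˡ (sum-cong-≋ {r}
            {λ b → (- ρ₀ (column b)) * ρ (suc b) (unit j)}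
            {λ b → (- ρ (suc b) (unit j)) * ρ₀ (column b)}
            λ b → solve 2 (λ x y → (:- x) :* y := (:- y) :* x) refl _ _)) (κ≈0 j)))
        (inj₂ ¬κ≈0) → ¬∀≈0⇒¬¬∃≉0 κ ¬κ≈0 >>= λ (j , κj≉0) → ¬¬-η (inj₂ (extended j κj≉0))

    adjoin : Dependent (λ i j → ρ (suc i) (unit j)) ⊎ RightInverse (ρ ∘ suc) →
      ¬ ¬ (Dependent (λ i j → ρ i (unit j)) ⊎ RightInverse ρ)
    adjoin (inj₁ (c , (i , ci≉0) , eq)) =
      ¬¬-η (inj₁ (0# Vector.∷ c , (suc i , ci≉0) , λ j →
        trans (+-cong (zeroˡ _) (eq j)) (+-identityˡ 0#)))
    adjoin (inj₂ inverse) = Step.step inverse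

-- The real and complex numbers as integral domains

private
  0<½ : ∀ {ε} → 0ℚ ℚ.< ε → 0ℚ ℚ.< ½ ℚ.* ε
  0<½ = half-pos _

  <⇒≱ : ∀ {p q} → p ℚ.< q → ¬ (q ℚ.≤ p)
  <⇒≱ p<q q≤p = ℚ.<-irrefl ≡.refl (ℚ.<-≤-trans p<q q≤p)

≈ᵣ-pointwise : ∀ {x y} → (∀ n → seq x n ≡ seq y n) → x ≈ᵣ y
≈ᵣ-pointwise {x} {y} eq ε 0<ε = 0 , λ n _ →
  ≡.subst (ℚ._< ε) (≡.sym (≡.cong ∣_∣ (≡.trans (≡.cong (ℚ._- seq y n) (eq n))
    (ℚ.+-inverseʳ (seq y n))))) 0<ε

≈ᵣ-sym : ∀ {x y} → x ≈ᵣ y → y ≈ᵣ x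
≈ᵣ-sym {x} {y} x≈y ε 0<ε with x≈y ε 0<ε
... | N , h = N , λ n n≥ → ≡.subst (ℚ._< ε)
  (≡.trans (≡.sym (ℚ.∣-p∣≡∣p∣ _)) (≡.cong ∣_∣ (flip (seq x n) (seq y n)))) (h n n≥)
  where
  flip : ∀ a b → ℚ.- (a ℚ.- b) ≡ b ℚ.- a
  flip = solve 2 (λ a b → :- (a :- b) := b :- a) ≡.refl
    where open +-*-Solver

triangle : ∀ {ε} a b c → ∣ a ℚ.- b ∣ ℚ.< ½ ℚ.* ε → ∣ b ℚ.- c ∣ ℚ.< ½ ℚ.* ε → ∣ a ℚ.- c ∣ ℚ.< ε
triangle {ε} a b c ab bc = begin-strict
  ∣ a ℚ.- c ∣                      ≡⟨ ≡.cong ∣_∣ (split a b c) ⟩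
  ∣ (a ℚ.- b) ℚ.+ (b ℚ.- c) ∣      ≤⟨ ℚ.∣p+q∣≤∣p∣+∣q∣ (a ℚ.- b) (b ℚ.- c) ⟩
  ∣ a ℚ.- b ∣ ℚ.+ ∣ b ℚ.- c ∣      <⟨ ℚ.+-mono-< ab bc ⟩
  ½ ℚ.* ε ℚ.+ ½ ℚ.* ε              ≡⟨ half+half ε ⟩
  ε                                ∎
  where
  open ℚ.≤-Reasoning
  split : ∀ a b c → a ℚ.- c ≡ (a ℚ.- b) ℚ.+ (b ℚ.- c)
  split = solve 3 (λ a b c → a :- c := (a :- b) :+ (b :- c)) ≡.refl
    where open +-*-Solver

≈ᵣ-trans : ∀ {x y z} → x ≈ᵣ y → y ≈ᵣ z → x ≈ᵣ z
≈ᵣ-trans {x} {y} {z} x≈y y≈z ε 0<ε with x≈y (½ ℚ.* ε) (0<½ 0<ε) | y≈z (½ ℚ.* ε) (0<½ 0<ε)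
... | M , f | N , g = M ℕ.⊔ N , λ n n≥ → triangle (seq x n) (seq y n) (seq z n)
  (f n (ℕ.m⊔n≤o⇒m≤o M N n≥)) (g n (ℕ.m⊔n≤o⇒n≤o M N n≥))

+ᵣ-cong : ∀ {x y u v} → x ≈ᵣ y → u ≈ᵣ v → x +ᵣ u ≈ᵣ y +ᵣ v
+ᵣ-cong {x} {y} {u} {v} x≈y u≈v ε 0<ε
  with x≈y (½ ℚ.* ε) (0<½ 0<ε) | u≈v (½ ℚ.* ε) (0<½ 0<ε)
... | M , f | N , g = M ℕ.⊔ N , λ n n≥ → begin-strict
  ∣ (seq x n ℚ.+ seq u n) ℚ.- (seq y n ℚ.+ seq v n) ∣
    ≡⟨ ≡.cong ∣_∣ (rearrange (seq x n) (seq u n) (seq y n) (seq v n)) ⟩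
  ∣ (seq x n ℚ.- seq y n) ℚ.+ (seq u n ℚ.- seq v n) ∣
    ≤⟨ ℚ.∣p+q∣≤∣p∣+∣q∣ (seq x n ℚ.- seq y n) (seq u n ℚ.- seq v n) ⟩
  ∣ seq x n ℚ.- seq y n ∣ ℚ.+ ∣ seq u n ℚ.- seq v n ∣
    <⟨ ℚ.+-mono-< (f n (ℕ.m⊔n≤o⇒m≤o M N n≥)) (g n (ℕ.m⊔n≤o⇒n≤o M N n≥)) ⟩
  ½ ℚ.* ε ℚ.+ ½ ℚ.* ε  ≡⟨ half+half ε ⟩
  ε                    ∎
  where
  open ℚ.≤-Reasoning
  rearrange : ∀ a b c d → (a ℚ.+ b) ℚ.- (c ℚ.+ d) ≡ (a ℚ.- c) ℚ.+ (b ℚ.- d)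
  rearrange = solve 4 (λ a b c d → (a :+ b) :- (c :+ d) := (a :- c) :+ (b :- d)) ≡.refl
    where open +-*-Solver

-ᵣ-cong : ∀ {x y} → x ≈ᵣ y → -ᵣ x ≈ᵣ -ᵣ y
-ᵣ-cong {x} {y} x≈y ε 0<ε with x≈y ε 0<ε
... | N , h = N , λ n n≥ → ≡.subst (ℚ._< ε)
  (≡.trans (≡.sym (ℚ.∣-p∣≡∣p∣ _)) (≡.cong ∣_∣ (rearrange (seq x n) (seq y n)))) (h n n≥)
  where
  rearrange : ∀ a b → ℚ.- (a ℚ.- b) ≡ (ℚ.- a) ℚ.- (ℚ.- b)
  rearrange = solve 2 (λ a b → :- (a :- b) := (:- a) :- (:- b)) ≡.refl
    where open +-*-Solver

*ᵣ-cong : ∀ {x y u v} → x ≈ᵣ y → u ≈ᵣ v → x *ᵣ u ≈ᵣ y *ᵣ v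
*ᵣ-cong {x} {y} {u} {v} x≈y u≈v ε 0<ε =
  let A , K , 0<A , x≤A = bounded {seq x} (cauchy x)
      B , L , 0<B , v≤B = bounded {seq v} (cauchy v)
      δ  , 0<δ  , Aδ≡  = scale A (½ ℚ.* ε) 0<A (0<½ 0<ε)
      δ′ , 0<δ′ , Bδ′≡ = scale B (½ ℚ.* ε) 0<B (0<½ 0<ε)
      M , f = x≈y δ′ 0<δ′
      N , g = u≈v δ 0<δ
  in (K ℕ.⊔ L) ℕ.⊔ (M ℕ.⊔ N) , λ n n≥ →
    let KL = ℕ.m⊔n≤o⇒m≤o (K ℕ.⊔ L) (M ℕ.⊔ N) n≥
        MN = ℕ.m⊔n≤o⇒n≤o (K ℕ.⊔ L) (M ℕ.⊔ N) n≥
    in ≡.subst (∣ seq x n ℚ.* seq u n ℚ.- seq y n ℚ.* seq v n ∣ ℚ.<_) (half+half ε)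
      (close (seq x n) (seq u n) (seq y n) (seq v n) 0<A 0<B Aδ≡ Bδ′≡
        (x≤A n (ℕ.m⊔n≤o⇒m≤o K L KL)) (v≤B n (ℕ.m⊔n≤o⇒n≤o K L KL))
        (g n (ℕ.m⊔n≤o⇒n≤o M N MN)) (f n (ℕ.m⊔n≤o⇒m≤o M N MN)))

ℝ-algebra : ℚAlgebra
ℝ-algebra = record
  { commutativeRing = record
    { Carrier = ℝ ; _≈_ = _≈ᵣ_ ; _+_ = _+ᵣ_ ; _*_ = _*ᵣ_ ; -_ = -ᵣ_
    ; 0# = fromℚ 0ℚ ; 1# = fromℚ 1ℚ
    ; isCommutativeRing = record
      { isRing = record
        { +-isAbelianGroup = record
          { isGroup = record
            { isMonoid = record
              { isSemigroup = record
                { isMagma = record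
                  { isEquivalence = record
                    { refl  = λ {x} → ≈ᵣ-pointwise {x} {x} (λ _ → ≡.refl)
                    ; sym   = λ {x} {y} → ≈ᵣ-sym {x} {y}
                    ; trans = λ {x} {y} {z} → ≈ᵣ-trans {x} {y} {z}
                    }
                  ; ∙-cong = λ {x} {y} {u} {v} → +ᵣ-cong {x} {y} {u} {v}
                  }
                ; assoc = λ x y z → ≈ᵣ-pointwise {(x +ᵣ y) +ᵣ z} {x +ᵣ (y +ᵣ z)}
                    λ n → ℚ.+-assoc (seq x n) (seq y n) (seq z n)
                }
              ; identity =
                  (λ x → ≈ᵣ-pointwise {fromℚ 0ℚ +ᵣ x} {x} λ n → ℚ.+-identityˡ (seq x n))
                , (λ x → ≈ᵣ-pointwise {x +ᵣ fromℚ 0ℚ} {x} λ n → ℚ.+-identityʳ (seq x n))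
              }
            ; inverse =
                (λ x → ≈ᵣ-pointwise {(-ᵣ x) +ᵣ x} {fromℚ 0ℚ} λ n → ℚ.+-inverseˡ (seq x n))
              , (λ x → ≈ᵣ-pointwise {x +ᵣ (-ᵣ x)} {fromℚ 0ℚ} λ n → ℚ.+-inverseʳ (seq x n))
            ; ⁻¹-cong = λ {x} {y} → -ᵣ-cong {x} {y}
            }
          ; comm = λ x y → ≈ᵣ-pointwise {x +ᵣ y} {y +ᵣ x}
              λ n → ℚ.+-comm (seq x n) (seq y n)
          }
        ; *-cong = λ {x} {y} {u} {v} → *ᵣ-cong {x} {y} {u} {v}
        ; *-assoc = λ x y z → ≈ᵣ-pointwise {(x *ᵣ y) *ᵣ z} {x *ᵣ (y *ᵣ z)}
            λ n → ℚ.*-assoc (seq x n) (seq y n) (seq z n)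
        ; *-identity =
            (λ x → ≈ᵣ-pointwise {fromℚ 1ℚ *ᵣ x} {x} λ n → ℚ.*-identityˡ (seq x n))
          , (λ x → ≈ᵣ-pointwise {x *ᵣ fromℚ 1ℚ} {x} λ n → ℚ.*-identityʳ (seq x n))
        ; distrib =
            (λ x y z → ≈ᵣ-pointwise {x *ᵣ (y +ᵣ z)} {x *ᵣ y +ᵣ x *ᵣ z}
              λ n → ℚ.*-distribˡ-+ (seq x n) (seq y n) (seq z n))
          , (λ x y z → ≈ᵣ-pointwise {(y +ᵣ z) *ᵣ x} {y *ᵣ x +ᵣ z *ᵣ x}
              λ n → ℚ.*-distribʳ-+ (seq x n) (seq y n) (seq z n))
        }
      ; *-comm = λ x y → ≈ᵣ-pointwise {x *ᵣ y} {y *ᵣ x} λ n → ℚ.*-comm (seq x n) (seq y n)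
      }
    }
  ; ι = fromℚ
  ; ι-hom = record
    { isSemiringHomomorphism = record
      { isNearSemiringHomomorphism = record
        { +-isMonoidHomomorphism = record
          { isMagmaHomomorphism = record
            { isRelHomomorphism = record
                { cong = λ { {p} ≡.refl → ≈ᵣ-pointwise {fromℚ p} {fromℚ p} λ _ → ≡.refl } }
            ; homo = λ p q → ≈ᵣ-pointwise {fromℚ (p ℚ.+ q)} {fromℚ p +ᵣ fromℚ q} λ _ → ≡.refl
            }
          ; ε-homo = ≈ᵣ-pointwise {fromℚ 0ℚ} {fromℚ 0ℚ} λ _ → ≡.refl
          }
        ; *-homo = λ p q → ≈ᵣ-pointwise {fromℚ (p ℚ.* q)} {fromℚ p *ᵣ fromℚ q} λ _ → ≡.refl
        }
      ; 1#-homo = ≈ᵣ-pointwise {fromℚ 1ℚ} {fromℚ 1ℚ} λ _ → ≡.refl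
      }
    ; -‿homo = λ p → ≈ᵣ-pointwise {fromℚ (ℚ.- p)} { -ᵣ fromℚ p} λ _ → ≡.refl
    }
  }

Apart : (ℕ → ℚ) → Set
Apart f = ∃ λ δ → 0ℚ ℚ.< δ × ∃ λ N → ∀ n → N ℕ.≤ n → δ ℚ.≤ ∣ f n ∣

-- A single sample, at an index beyond which f varies by less than ε / 4,
-- decides.
locate : ∀ {f} → Cauchy f → ∀ ε → 0ℚ ℚ.< ε →
  (∃ λ N → ∀ n → N ℕ.≤ n → ∣ f n ∣ ℚ.< ε) ⊎ Apart f
locate {f} cf ε 0<ε = decide (cf η′ 0<η′)
  where
  η  = ½ ℚ.* ε
  η′ = ½ ℚ.* η
  0<η  = 0<½ 0<ε
  0<η′ = 0<½ 0<η

  η′<η : η′ ℚ.< η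
  η′<η = ≡.subst₂ ℚ._<_ (ℚ.+-identityʳ η′) (half+half η) (ℚ.+-monoʳ-< η′ 0<η′)

  triangle₀ : ∀ {ε} a b → ∣ a ℚ.- b ∣ ℚ.< ½ ℚ.* ε → ∣ b ∣ ℚ.< ½ ℚ.* ε → ∣ a ∣ ℚ.< ε
  triangle₀ {ε} a b ab b< = ≡.subst (λ t → ∣ t ∣ ℚ.< ε) (ℚ.+-identityʳ a)
    (triangle a b 0ℚ ab (≡.subst (λ t → ∣ t ∣ ℚ.< ½ ℚ.* ε) (≡.sym (ℚ.+-identityʳ b)) b<))

  decide : (∃ λ N → ∀ m n → N ℕ.≤ m → N ℕ.≤ n → ∣ f m ℚ.- f n ∣ ℚ.< η′) →
    (∃ λ N → ∀ n → N ℕ.≤ n → ∣ f n ∣ ℚ.< ε) ⊎ Apart f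
  decide (N , h) with ∣ f N ∣ ℚ.<? η
  ... | yes fN<η = inj₁ (N , λ n n≥ →
          triangle₀ (f n) (f N) (ℚ.<-trans (h n N n≥ ℕ.≤-refl) η′<η) fN<η)
  ... | no fN≮η = inj₂ (η′ , 0<η′ , N , λ n n≥ → ℚ.≮⇒≥ λ fn<η′ →
          fN≮η (triangle₀ (f N) (f n) (h N n ℕ.≤-refl n≥) fn<η′))

-- For each ε, `locate` decides; being bounded away from 0 would refute the equality outright.
≈ᵣ-stable : ∀ {x y} → ¬ ¬ (x ≈ᵣ y) → x ≈ᵣ y
≈ᵣ-stable {x} {y} nn ε 0<ε with locate {seq (x -ᵣ y)} (cauchy (x -ᵣ y)) ε 0<ε
... | inj₁ small = small
... | inj₂ (δ , 0<δ , N , apart) = ⊥-elim (nn λ x≈y →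
  let M , close = x≈y δ 0<δ
  in <⇒≱ (close (M ℕ.⊔ N) (ℕ.m≤m⊔n M N)) (apart (M ℕ.⊔ N) (ℕ.m≤n⊔m M N)))

-- Removing the double negation from the conclusion would amount to Markov's principle.
≉0⇒apart : ∀ {x} → ¬ (x ≈ᵣ fromℚ 0ℚ) → ¬ ¬ Apart (seq x)
≉0⇒apart {x} x≉0 ¬apart = x≉0 λ ε 0<ε → nearby ε (locate {seq x} (cauchy x) ε 0<ε)
  where
  nearby : ∀ ε → (∃ λ N → ∀ n → N ℕ.≤ n → ∣ seq x n ∣ ℚ.< ε) ⊎ Apart (seq x) →
    ∃ λ N → ∀ n → N ℕ.≤ n → ∣ seq x n ℚ.- 0ℚ ∣ ℚ.< ε
  nearby ε (inj₁ (N , small)) = N , λ n n≥ →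
    ≡.subst (λ t → ∣ t ∣ ℚ.< ε) (≡.sym (ℚ.+-identityʳ (seq x n))) (small n n≥)
  nearby ε (inj₂ apart) = ⊥-elim (¬apart apart)

*ᵣ-cancel : ∀ {x y} → ¬ (x ≈ᵣ fromℚ 0ℚ) → x *ᵣ y ≈ᵣ fromℚ 0ℚ → y ≈ᵣ fromℚ 0ℚ
*ᵣ-cancel {x} {y} x≉0 xy≈0 = ≈ᵣ-stable {y} {fromℚ 0ℚ} (≉0⇒apart {x} x≉0 >>= λ apart → ¬¬-η (small-y apart))
  where
  small-y : Apart (seq x) → y ≈ᵣ fromℚ 0ℚ
  small-y (δ , 0<δ , N , δ≤x) ε 0<ε =
    -- Where |x| ≥ δ, |x y| < δ ε forces |y| < ε.
    let M , xy< = xy≈0 (δ ℚ.* ε) 0<δε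
    in M ℕ.⊔ N , λ n n≥ → ≡.subst (λ t → ∣ t ∣ ℚ.< ε) (≡.sym (ℚ.+-identityʳ (seq y n)))
      (ℚ.≰⇒> λ ε≤y → <⇒≱ (xy< n (ℕ.m⊔n≤o⇒m≤o M N n≥)) (begin
        δ ℚ.* ε                        ≤⟨ ℚ.*-monoˡ-≤-nonNeg δ {{ℚ.nonNegative (ℚ.<⇒≤ 0<δ)}} ε≤y ⟩
        δ ℚ.* ∣ seq y n ∣
          ≤⟨ ℚ.*-monoʳ-≤-nonNeg ∣ seq y n ∣ {{ℚ.nonNegative (ℚ.0≤∣p∣ (seq y n))}}
               (δ≤x n (ℕ.m⊔n≤o⇒n≤o M N n≥)) ⟩
        ∣ seq x n ∣ ℚ.* ∣ seq y n ∣    ≡⟨ ℚ.∣p*q∣≡∣p∣*∣q∣ (seq x n) (seq y n) ⟨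
        ∣ seq x n ℚ.* seq y n ∣        ≡⟨ ≡.cong ∣_∣ (ℚ.+-identityʳ (seq x n ℚ.* seq y n)) ⟨
        ∣ seq x n ℚ.* seq y n ℚ.- 0ℚ ∣ ∎))
    where
    open ℚ.≤-Reasoning
    0<δε : 0ℚ ℚ.< δ ℚ.* ε
    0<δε = ≡.subst (ℚ._< δ ℚ.* ε) (ℚ.*-zeroʳ δ) (ℚ.*-monoʳ-<-pos δ {{ℚ.positive 0<δ}} 0<ε)

fromℚ-injective : ∀ {q} → fromℚ q ≈ᵣ fromℚ 0ℚ → q ≡ 0ℚ
fromℚ-injective {q} q≈0 with q ℚ.≟ 0ℚ
... | yes q≡0 = q≡0
... | no q≢0 = ⊥-elim (let N , h = q≈0 ∣ q ∣ 0<∣q∣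
  in ℚ.<-irrefl (≡.cong ∣_∣ (ℚ.+-identityʳ q)) (h N ℕ.≤-refl))
  where
  0<∣q∣ : 0ℚ ℚ.< ∣ q ∣
  0<∣q∣ = ℚ.≰⇒> λ ∣q∣≤0 → q≢0 (ℚ.∣p∣≡0⇒p≡0 q (ℚ.≤-antisym ∣q∣≤0 (ℚ.0≤∣p∣ q)))

ℝ-domain : Domain
ℝ-domain = record
  { algebra     = ℝ-algebra
  ; stable      = λ {x} {y} → ≈ᵣ-stable {x} {y}
  ; *-cancel    = λ {x} {y} → *ᵣ-cancel {x} {y}
  ; ι-injective = fromℚ-injective
  }

-- Where |x| ≥ δ, the sum is at least δ², which excludes x being apart from 0.
x²+y²≈0⇒x≈0 : ∀ {x y} → x *ᵣ x +ᵣ y *ᵣ y ≈ᵣ fromℚ 0ℚ → x ≈ᵣ fromℚ 0ℚ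
x²+y²≈0⇒x≈0 {x} {y} sum≈0 = ≈ᵣ-stable {x} {fromℚ 0ℚ} λ x≉0 →
  ≉0⇒apart {x} x≉0 λ (δ , 0<δ , N , δ≤x) →
  let 0<δδ = ≡.subst (ℚ._< δ ℚ.* δ) (ℚ.*-zeroʳ δ) (ℚ.*-monoʳ-<-pos δ {{ℚ.positive 0<δ}} 0<δ)
      M , small = sum≈0 (δ ℚ.* δ) 0<δδ
      n = M ℕ.⊔ N
  in <⇒≱ (small n (ℕ.m≤m⊔n M N)) (bound 0<δ (seq x n) (seq y n) (δ≤x n (ℕ.m≤n⊔m M N)))
  where
  open ℚ.≤-Reasoning
  square : ∀ a → a ℚ.* a ≡ ∣ a ∣ ℚ.* ∣ a ∣
  square a with ℚ.∣p∣≡p∨∣p∣≡-p a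
  ... | inj₁ eq = ≡.sym (≡.cong₂ ℚ._*_ eq eq)
  ... | inj₂ eq = ≡.trans (neg² a) (≡.sym (≡.cong₂ ℚ._*_ eq eq))
    where
    neg² : ∀ a → a ℚ.* a ≡ (ℚ.- a) ℚ.* (ℚ.- a)
    neg² = solve 1 (λ a → a :* a := (:- a) :* (:- a)) ≡.refl
      where open +-*-Solver

  mono : ∀ {a b} → 0ℚ ℚ.≤ a → a ℚ.≤ b → a ℚ.* a ℚ.≤ b ℚ.* b
  mono {a} {b} 0≤a a≤b = ℚ.≤-trans (ℚ.*-monoˡ-≤-nonNeg a {{ℚ.nonNegative 0≤a}} a≤b)
    (ℚ.*-monoʳ-≤-nonNeg b {{ℚ.nonNegative (ℚ.≤-trans 0≤a a≤b)}} a≤b)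

  bound : ∀ {δ} → 0ℚ ℚ.< δ → ∀ a b → δ ℚ.≤ ∣ a ∣ →
    δ ℚ.* δ ℚ.≤ ∣ (a ℚ.* a ℚ.+ b ℚ.* b) ℚ.- 0ℚ ∣
  bound {δ} 0<δ a b δ≤a = begin
    δ ℚ.* δ                              ≤⟨ mono (ℚ.<⇒≤ 0<δ) δ≤a ⟩
    ∣ a ∣ ℚ.* ∣ a ∣                      ≡⟨ square a ⟨
    a ℚ.* a                              ≡⟨ ℚ.+-identityʳ (a ℚ.* a) ⟨
    a ℚ.* a ℚ.+ 0ℚ                       ≤⟨ ℚ.+-monoʳ-≤ (a ℚ.* a) 0≤bb ⟩
    a ℚ.* a ℚ.+ b ℚ.* b                  ≡⟨ ℚ.0≤p⇒∣p∣≡p (ℚ.+-mono-≤ 0≤aa 0≤bb) ⟨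
    ∣ a ℚ.* a ℚ.+ b ℚ.* b ∣              ≡⟨ ≡.cong ∣_∣ (ℚ.+-identityʳ _) ⟨
    ∣ (a ℚ.* a ℚ.+ b ℚ.* b) ℚ.- 0ℚ ∣     ∎
    where
    0≤square : ∀ a → 0ℚ ℚ.≤ a ℚ.* a
    0≤square a = ≡.subst (0ℚ ℚ.≤_) (≡.sym (square a)) (mono ℚ.≤-refl (ℚ.0≤∣p∣ a))
    0≤aa = 0≤square a
    0≤bb = 0≤square b

module _ (R : ℚAlgebra) where
  open ℚAlgebra R
  open Solver

  -- R[i], over an arbitrary `R` so that the solver of `R` proves its laws; ℂ inherits them along
  -- `toGaussian`.
  gaussian : ℚAlgebra
  gaussian = record
    { commutativeRing = record
      { Carrier = Carrier × Carrier
      ; _≈_ = λ x y → (proj₁ x ≈ proj₁ y) × (proj₂ x ≈ proj₂ y)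
      ; _+_ = λ x y → proj₁ x + proj₁ y , proj₂ x + proj₂ y
      ; _*_ = λ x y → proj₁ x * proj₁ y + - (proj₂ x * proj₂ y)
                    , proj₁ x * proj₂ y + proj₂ x * proj₁ y
      ; -_  = λ x → - proj₁ x , - proj₂ x
      ; 0#  = 0# , 0#
      ; 1#  = 1# , 0#
      ; isCommutativeRing = record
        { isRing = record
          -- R[i] and R[ε] have the same additive group.
          { +-isAbelianGroup = CommutativeRing.+-isAbelianGroup
              (ℚAlgebra.commutativeRing (dual R))
          ; *-cong = λ (p , q) (r , s) →
              +-cong (*-cong p r) (-‿cong (*-cong q s)) , +-cong (*-cong p s) (*-cong q r)
          ; *-assoc = λ x y z →
              solve 6 (λ a a′ b b′ c c′ →
                (a :* b :+ :- (a′ :* b′)) :* c :+ :- ((a :* b′ :+ a′ :* b) :* c′)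
                := a :* (b :* c :+ :- (b′ :* c′)) :+ :- (a′ :* (b :* c′ :+ b′ :* c)))
                refl _ _ _ _ _ _
            , solve 6 (λ a a′ b b′ c c′ →
                (a :* b :+ :- (a′ :* b′)) :* c′ :+ (a :* b′ :+ a′ :* b) :* c
                := a :* (b :* c′ :+ b′ :* c) :+ a′ :* (b :* c :+ :- (b′ :* c′)))
                refl _ _ _ _ _ _
          ; *-identity =
              (λ x → solve 2 (λ a a′ → con 1ℚ :* a :+ :- (con 0ℚ :* a′) := a) refl _ _
                   , solve 2 (λ a a′ → con 1ℚ :* a′ :+ con 0ℚ :* a := a′) refl _ _)
            , (λ x → solve 2 (λ a a′ → a :* con 1ℚ :+ :- (a′ :* con 0ℚ) := a) refl _ _
                   , solve 2 (λ a a′ → a :* con 0ℚ :+ a′ :* con 1ℚ := a′) refl _ _)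
          ; distrib =
              (λ x y z →
                solve 6 (λ a a′ b b′ c c′ → a :* (b :+ c) :+ :- (a′ :* (b′ :+ c′))
                  := (a :* b :+ :- (a′ :* b′)) :+ (a :* c :+ :- (a′ :* c′)))
                  refl _ _ _ _ _ _
              , solve 6 (λ a a′ b b′ c c′ → a :* (b′ :+ c′) :+ a′ :* (b :+ c)
                  := (a :* b′ :+ a′ :* b) :+ (a :* c′ :+ a′ :* c)) refl _ _ _ _ _ _)
            , (λ x y z →
                solve 6 (λ a a′ b b′ c c′ → (b :+ c) :* a :+ :- ((b′ :+ c′) :* a′)
                  := (b :* a :+ :- (b′ :* a′)) :+ (c :* a :+ :- (c′ :* a′)))
                  refl _ _ _ _ _ _
              , solve 6 (λ a a′ b b′ c c′ → (b :+ c) :* a′ :+ (b′ :+ c′) :* a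
                  := (b :* a′ :+ b′ :* a) :+ (c :* a′ :+ c′ :* a)) refl _ _ _ _ _ _)
          }
        ; *-comm = λ x y →
            solve 4 (λ a a′ b b′ → a :* b :+ :- (a′ :* b′) := b :* a :+ :- (b′ :* a′))
              refl _ _ _ _
          , solve 4 (λ a a′ b b′ → a :* b′ :+ a′ :* b := b :* a′ :+ b′ :* a) refl _ _ _ _
        }
      }
    ; ι = λ q → ι q , 0#
    ; ι-hom = record
      { isSemiringHomomorphism = record
        { isNearSemiringHomomorphism = record
          { +-isMonoidHomomorphism =
              ℚAlgebra.ι.+-isMonoidHomomorphism (dual R)
          ; *-homo = λ p q →
              trans (ι.*-homo p q)
                (solve 2 (λ a b → a :* b := a :* b :+ :- (con 0ℚ :* con 0ℚ)) refl _ _)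
            , solve 2 (λ a b → con 0ℚ := a :* con 0ℚ :+ con 0ℚ :* b) refl (ι p) (ι q)
          }
        ; 1#-homo = ι.1#-homo , refl
        }
      ; -‿homo = ℚAlgebra.ι.-‿homo (dual R)
      }
    }

module _ (R : Domain) where
  open Domain R
  open Solver
  private
    module G = ℚAlgebra (gaussian algebra)

  -- Multiplying by the conjugate of z reduces the claim to cancelling the norm a² + b², which
  -- `real` makes nonzero.
  gaussian-*-cancel : (∀ {x y} → x * x + y * y ≈ 0# → x ≈ 0#) →
    ∀ {z w} → ¬ (z G.≈ G.0#) → (z G.* w) G.≈ G.0# → w G.≈ G.0#
  gaussian-*-cancel real {a , b} {c , d} z≉0 (re≈0 , im≈0) =
      *-cancel norm≉0 (trans
        (solve 4 (λ a b c d → (a :* a :+ b :* b) :* c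
            := a :* (a :* c :+ :- (b :* d)) :+ b :* (a :* d :+ b :* c)) refl a b c d)
        (combination a b))
    , *-cancel norm≉0 (trans
        (solve 4 (λ a b c d → (a :* a :+ b :* b) :* d
            := (:- b) :* (a :* c :+ :- (b :* d)) :+ a :* (a :* d :+ b :* c)) refl a b c d)
        (combination (- b) a))
    where
    norm≉0 : ¬ (a * a + b * b ≈ 0#)
    norm≉0 eq = z≉0 (real eq , real (trans (+-comm _ _) eq))

    combination : ∀ x y → x * (a * c + - (b * d)) + y * (a * d + b * c) ≈ 0#
    combination x y = trans (+-cong (trans (*-congˡ re≈0) (zeroʳ x))
      (trans (*-congˡ im≈0) (zeroʳ y))) (+-identityˡ 0#)

private
  module G = ℚAlgebra (gaussian ℝ-algebra)

  toGaussian : ℂ → G.Carrier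
  toGaussian z = re z , im z

  toGaussian-isMonomorphism : RingMorphisms.IsRingMonomorphism ℂ-rawRing G.rawRing toGaussian
  toGaussian-isMonomorphism = record
    { isRingHomomorphism = record
      { isSemiringHomomorphism = record
        { isNearSemiringHomomorphism = record
          { +-isMonoidHomomorphism = record
            { isMagmaHomomorphism = record
              { isRelHomomorphism = record { cong = λ eq → eq }
              ; homo = λ x y → G.refl {toGaussian x G.+ toGaussian y}
              }
            ; ε-homo = G.refl {G.0#}
            }
          ; *-homo = λ x y → G.refl {toGaussian x G.* toGaussian y}
          }
        ; 1#-homo = G.refl {G.1#}
        }
      ; -‿homo = λ x → G.refl {G.- toGaussian x}
      }
    ; injective = λ eq → eq
    }

ℂ-algebra : ℚAlgebra
ℂ-algebra = record
  { commutativeRing = record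
    { isCommutativeRing = RingMonomorphism.isCommutativeRing toGaussian-isMonomorphism
        G.isCommutativeRing }
  ; ι = ℚ→ℂ
  ; ι-hom = record
    { isSemiringHomomorphism = record
      { isNearSemiringHomomorphism = record
        { +-isMonoidHomomorphism = record
          { isMagmaHomomorphism = record
            { isRelHomomorphism = record { cong = λ { {p} ≡.refl → G.refl {G.ι p} } }
            ; homo = G.ι.+-homo
            }
          ; ε-homo = G.ι.0#-homo
          }
        ; *-homo = G.ι.*-homo
        }
      ; 1#-homo = G.ι.1#-homo
      }
    ; -‿homo = G.ι.-‿homo
    }
  }

ℂ-domain : Domain
ℂ-domain = record
  { algebra     = ℂ-algebra
  ; stable      = λ {z} {w} nn →
      ≈ᵣ-stable {re z} {re w} (nn >>= λ eq → ¬¬-η (proj₁ eq))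
    , ≈ᵣ-stable {im z} {im w} (nn >>= λ eq → ¬¬-η (proj₂ eq))
  ; *-cancel    = λ {z} {w} → gaussian-*-cancel ℝ-domain
      (λ {x} {y} → x²+y²≈0⇒x≈0 {x} {y}) {toGaussian z} {toGaussian w}
  ; ι-injective = λ eq → fromℚ-injective (proj₁ eq)
  }

-- Infinitesimal geometry of realisations

concat-combine : ∀ {a} {A : Set a} {n} (xs : Vector (Vector A 2) n) w i →
  Vector.concat xs (combine w i) ≡ xs w i
concat-combine xs w i = ≡.cong (uncurry xs) (Fin.remQuot-combine w i)

module Geometry (K : Domain) where
  open Domain K
  open Over rawRing ι
    using (Point; _⊖_; d; Realisation; Generic; Equivalent; AlgebraicallyIndependent)
  open Solver

  e₀ e₁ : Point
  e₀ = 1# Vector.∷ 0# Vector.∷ Vector.[]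
  e₁ = 0# Vector.∷ 1# Vector.∷ Vector.[]

  infix 7 _·_

  _·_ : Point → Point → Carrier
  P · Q = P zero * Q zero + P (suc zero) * Q (suc zero)

  det : Point → Point → Carrier
  det P Q = P zero * Q (suc zero) + - (P (suc zero) * Q zero)

  x≈0×y≈0⇒x+y≈0 : ∀ {x y} → x ≈ 0# → y ≈ 0# → x + y ≈ 0#
  x≈0×y≈0⇒x+y≈0 x≈0 y≈0 = trans (+-cong x≈0 y≈0) (+-identityʳ 0#)

  y≈0⇒x*y≈0 : ∀ {x y} → y ≈ 0# → x * y ≈ 0#
  y≈0⇒x*y≈0 {x} y≈0 = trans (*-congˡ y≈0) (zeroʳ x)

  x≈0⇒x*y≈0 : ∀ {x y} → x ≈ 0# → x * y ≈ 0#
  x≈0⇒x*y≈0 {x} {y} x≈0 = trans (*-congʳ x≈0) (zeroˡ y)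

  x+x≈0⇒x≈0 : ∀ {x} → x + x ≈ 0# → x ≈ 0#
  x+x≈0⇒x≈0 {x} eq = *-cancel {ι (fromℕ 2)} (fromℕ-suc≢0 1 ∘ ι-injective) (begin
    ι (fromℕ 2) * x                    ≈⟨ *-congʳ (ι.+-homo 1ℚ (1ℚ ℚ.+ 0ℚ)) ⟩
    (ι 1ℚ + ι (1ℚ ℚ.+ 0ℚ)) * x         ≈⟨ *-congʳ (+-cong ι.1#-homo ι.1#-homo) ⟩
    (1# + 1#) * x
      ≈⟨ solve 1 (λ x → (con 1ℚ :+ con 1ℚ) :* x := x :+ x) refl x ⟩
    x + x                              ≈⟨ eq ⟩
    0#                                 ∎)

  -- With N the matrix whose rows are η₁ / σ₁ and η₂ / σ₂, the hypotheses say
  -- aᵢ = N bᵢ.  The linear relation between the aᵢ therefore also holds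
  -- between the bᵢ, and polarising it along |aᵢ|² = |bᵢ|² compares the
  -- remaining scalar product.
  isometric-triple : ∀ (a b : Fin 3 → Point) (η₁ η₂ : Point) {σ₁ σ₂} →
    ¬ (σ₁ ≈ 0#) → ¬ (σ₂ ≈ 0#) →
    (∀ i → b i · η₁ ≈ σ₁ * a i zero) → (∀ i → b i · η₂ ≈ σ₂ * a i (suc zero)) →
    (∀ i → a i · a i ≈ b i · b i) →
    ¬ (det (a (suc zero)) (a (suc (suc zero))) ≈ 0#) →
    ¬ (det (a (suc (suc zero))) (a zero) ≈ 0#) →
    ¬ (det (a zero) (a (suc zero)) ≈ 0#) →
    a zero · a (suc zero) ≈ b zero · b (suc zero)
  isometric-triple a b η₁ η₂ {σ₁} {σ₂} σ₁≉0 σ₂≉0 eq₁ eq₂ norm c₁≉0 c₂≉0 c₃≉0 =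
    x∙y⁻¹≈ε⇒x≈y _ _ (x+x≈0⇒x≈0 (*-cancel (*-≉0 c₁≉0 c₂≉0) (begin
      (c₁ * c₂) * ((A₁₂ + - B₁₂) + (A₁₂ + - B₁₂))
        ≈⟨ solve 8 (λ c₁ c₂ c₃ A₁₂ B₁₂ A₁ A₂ A₃ →
             (c₁ :* c₂) :* ((A₁₂ :+ :- B₁₂) :+ (A₁₂ :+ :- B₁₂)) :=
             (c₁ :* c₁ :* A₁ :+ (c₁ :* c₂) :* (A₁₂ :+ A₁₂) :+ c₂ :* c₂ :* A₂ :+ :- (c₃ :* c₃ :* A₃))
             :+ :- (c₁ :* c₁ :* A₁ :+ (c₁ :* c₂) :* (B₁₂ :+ B₁₂) :+ c₂ :* c₂ :* A₂
                    :+ :- (c₃ :* c₃ :* A₃)))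
             refl c₁ c₂ c₃ A₁₂ B₁₂ (a₁ · a₁) (a₂ · a₂) (a₃ · a₃) ⟩
      polar (a₁ · a₁) (a₂ · a₂) (a₃ · a₃) A₁₂ + - polar (a₁ · a₁) (a₂ · a₂) (a₃ · a₃) B₁₂
        ≈⟨ +-congˡ (-‿cong (+-cong (+-cong (+-congʳ (*-congˡ (norm zero)))
             (*-congˡ (norm (suc zero)))) (-‿cong (*-congˡ (norm (suc (suc zero))))))) ⟩
      polar (a₁ · a₁) (a₂ · a₂) (a₃ · a₃) A₁₂ + - polar (b₁ · b₁) (b₂ · b₂) (b₃ · b₃) B₁₂
        ≈⟨ +-cong (polar≈0 a cramer) (-‿cong (polar≈0 b relation)) ⟩
      0# + - 0#
        ≈⟨ -‿inverseʳ 0# ⟩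
      0# ∎)))
    where
    a₁ = a zero
    a₂ = a (suc zero)
    a₃ = a (suc (suc zero))
    b₁ = b zero
    b₂ = b (suc zero)
    b₃ = b (suc (suc zero))
    c₁ = det a₂ a₃
    c₂ = det a₃ a₁
    c₃ = det a₁ a₂
    A₁₂ = a₁ · a₂
    B₁₂ = b₁ · b₂

    -- |c₁x₁ + c₂x₂|² - |c₃x₃|², expanded. It is a difference of squares with factor c₁x₁ + c₂x₂ +
    -- c₃x₃, in each coordinate.
    polar : Carrier → Carrier → Carrier → Carrier → Carrier
    polar x₁ x₂ x₃ x₁₂ = c₁ * c₁ * x₁ + (c₁ * c₂) * (x₁₂ + x₁₂) + c₂ * c₂ * x₂ + - (c₃ * c₃ * x₃)

    combination : (Fin 3 → Carrier) → Carrier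
    combination x = c₁ * x zero + c₂ * x (suc zero) + c₃ * x (suc (suc zero))

    polar≈0 : ∀ (x : Fin 3 → Point) → (∀ j → combination (λ i → x i j) ≈ 0#) →
      let x₁ = x zero ; x₂ = x (suc zero) ; x₃ = x (suc (suc zero)) in
      polar (x₁ · x₁) (x₂ · x₂) (x₃ · x₃) (x₁ · x₂) ≈ 0#
    polar≈0 x rel = trans
      (solve 9 (λ c₁ c₂ c₃ x₁ y₁ x₂ y₂ x₃ y₃ →
         c₁ :* c₁ :* (x₁ :* x₁ :+ y₁ :* y₁)
         :+ (c₁ :* c₂) :* ((x₁ :* x₂ :+ y₁ :* y₂) :+ (x₁ :* x₂ :+ y₁ :* y₂))
         :+ c₂ :* c₂ :* (x₂ :* x₂ :+ y₂ :* y₂) :+ :- (c₃ :* c₃ :* (x₃ :* x₃ :+ y₃ :* y₃)) :=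
         (c₁ :* x₁ :+ c₂ :* x₂ :+ :- (c₃ :* x₃)) :* (c₁ :* x₁ :+ c₂ :* x₂ :+ c₃ :* x₃)
         :+ (c₁ :* y₁ :+ c₂ :* y₂ :+ :- (c₃ :* y₃)) :* (c₁ :* y₁ :+ c₂ :* y₂ :+ c₃ :* y₃))
         refl _ _ _ _ _ _ _ _ _)
      (x≈0×y≈0⇒x+y≈0 (y≈0⇒x*y≈0 (rel zero)) (y≈0⇒x*y≈0 (rel (suc zero))))

    -- The expansion of a 3 × 3 determinant with a repeated row.
    cramer : ∀ j → combination (λ i → a i j) ≈ 0#
    cramer zero = solve 6 (λ x₁ y₁ x₂ y₂ x₃ y₃ →
      (x₂ :* y₃ :+ :- (y₂ :* x₃)) :* x₁ :+ (x₃ :* y₁ :+ :- (y₃ :* x₁)) :* x₂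
      :+ (x₁ :* y₂ :+ :- (y₁ :* x₂)) :* x₃ := con 0ℚ) refl _ _ _ _ _ _
    cramer (suc zero) = solve 6 (λ x₁ y₁ x₂ y₂ x₃ y₃ →
      (x₂ :* y₃ :+ :- (y₂ :* x₃)) :* y₁ :+ (x₃ :* y₁ :+ :- (y₃ :* x₁)) :* y₂
      :+ (x₁ :* y₂ :+ :- (y₁ :* x₂)) :* y₃ := con 0ℚ) refl _ _ _ _ _ _

    w : Point
    w j = combination (λ i → b i j)

    w·η : ∀ η {σ} j → (∀ i → b i · η ≈ σ * a i j) → w · η ≈ 0#
    w·η η {σ} j eq = begin
      w · η
        ≈⟨ solve 11 (λ c₁ c₂ c₃ x₁ y₁ x₂ y₂ x₃ y₃ u v →
             (c₁ :* x₁ :+ c₂ :* x₂ :+ c₃ :* x₃) :* u :+ (c₁ :* y₁ :+ c₂ :* y₂ :+ c₃ :* y₃) :* v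
             := c₁ :* (x₁ :* u :+ y₁ :* v) :+ c₂ :* (x₂ :* u :+ y₂ :* v)
                :+ c₃ :* (x₃ :* u :+ y₃ :* v)) refl _ _ _ _ _ _ _ _ _ _ _ ⟩
      combination (λ i → b i · η)
        ≈⟨ +-cong (+-cong (*-congˡ (eq zero)) (*-congˡ (eq (suc zero))))
                  (*-congˡ (eq (suc (suc zero)))) ⟩
      combination (λ i → σ * a i j)
        ≈⟨ solve 7 (λ c₁ c₂ c₃ s x y z → c₁ :* (s :* x) :+ c₂ :* (s :* y) :+ c₃ :* (s :* z)
             := s :* (c₁ :* x :+ c₂ :* y :+ c₃ :* z)) refl _ _ _ _ _ _ _ ⟩
      σ * combination (λ i → a i j)
        ≈⟨ y≈0⇒x*y≈0 (cramer j) ⟩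
      0# ∎

    -- Multiplicativity of the determinant: σ₁ σ₂ det(a₁, a₂) = det(b₁, b₂) det(η₁, η₂).
    det-η≉0 : ¬ (det η₁ η₂ ≈ 0#)
    det-η≉0 det≈0 = *-≉0 (*-≉0 σ₁≉0 σ₂≉0) c₃≉0 (begin
      (σ₁ * σ₂) * c₃
        ≈⟨ solve 6 (λ s t x₁ y₁ x₂ y₂ → (s :* t) :* (x₁ :* y₂ :+ :- (y₁ :* x₂)) :=
             (s :* x₁) :* (t :* y₂) :+ :- ((t :* y₁) :* (s :* x₂))) refl _ _ _ _ _ _ ⟩
      (σ₁ * a₁ zero) * (σ₂ * a₂ (suc zero)) + - ((σ₂ * a₁ (suc zero)) * (σ₁ * a₂ zero))
        ≈⟨ +-cong (*-cong (eq₁ zero) (eq₂ (suc zero)))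
                  (-‿cong (*-cong (eq₂ zero) (eq₁ (suc zero)))) ⟨
      (b₁ · η₁) * (b₂ · η₂) + - ((b₁ · η₂) * (b₂ · η₁))
        ≈⟨ solve 8 (λ x₁ y₁ x₂ y₂ u₁ v₁ u₂ v₂ →
             (x₁ :* u₁ :+ y₁ :* v₁) :* (x₂ :* u₂ :+ y₂ :* v₂)
             :+ :- ((x₁ :* u₂ :+ y₁ :* v₂) :* (x₂ :* u₁ :+ y₂ :* v₁))
             := (x₁ :* y₂ :+ :- (y₁ :* x₂)) :* (u₁ :* v₂ :+ :- (v₁ :* u₂)))
             refl _ _ _ _ _ _ _ _ ⟩
      det b₁ b₂ * det η₁ η₂
        ≈⟨ y≈0⇒x*y≈0 det≈0 ⟩
      0# ∎)

    -- `w` is orthogonal to the independent vectors `η₁` and `η₂`.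
    relation : ∀ j → w j ≈ 0#
    relation zero = *-cancel det-η≉0 (trans
      (solve 6 (λ x y u₁ v₁ u₂ v₂ → (u₁ :* v₂ :+ :- (v₁ :* u₂)) :* x :=
         v₂ :* (x :* u₁ :+ y :* v₁) :+ (:- v₁) :* (x :* u₂ :+ y :* v₂))
         refl (w zero) (w (suc zero)) _ _ _ _)
      (x≈0×y≈0⇒x+y≈0 (y≈0⇒x*y≈0 (w·η η₁ zero eq₁)) (y≈0⇒x*y≈0 (w·η η₂ (suc zero) eq₂))))
    relation (suc zero) = *-cancel det-η≉0 (trans
      (solve 6 (λ x y u₁ v₁ u₂ v₂ → (u₁ :* v₂ :+ :- (v₁ :* u₂)) :* y :=
         (:- u₂) :* (x :* u₁ :+ y :* v₁) :+ u₁ :* (x :* u₂ :+ y :* v₂))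
         refl (w zero) (w (suc zero)) _ _ _ _)
      (x≈0×y≈0⇒x+y≈0 (y≈0⇒x*y≈0 (w·η η₁ zero eq₁)) (y≈0⇒x*y≈0 (w·η η₂ (suc zero) eq₂))))

module PolynomialGeometry (k : ℕ) where
  open Over (polyRawRing k) (constᴾ k) public using (Point; _⊖_; d)

  detᴾ : Point → Point → Poly k
  detᴾ P Q = addᴾ k (mulᴾ k (P zero) (Q (suc zero))) (negᴾ k (mulᴾ k (P (suc zero)) (Q zero)))

module _ (R : ℚAlgebra) where
  open ℚAlgebra R
  open Evaluation R
  private
    module P = PolynomialGeometry
    module O = Over rawRing ι

  eval-⊖ : ∀ k (P Q : P.Point k) X i →
    eval k (P._⊖_ k P Q i) X ≈ eval k (P i) X + - eval k (Q i) X
  eval-⊖ k P Q X i = trans (eval-add k (P i) (negᴾ k (Q i)) X) (+-congˡ (eval-neg k (Q i) X))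

  eval-d : ∀ k (P : P.Point k) X → eval k (P.d k P) X ≈ O.d (λ i → eval k (P i) X)
  eval-d k P X = trans (eval-add k _ _ X) (+-cong (eval-mul k (P zero) (P zero) X)
    (eval-mul k (P (suc zero)) (P (suc zero)) X))

  d-cong : ∀ {P Q} → (∀ i → P i ≈ Q i) → O.d P ≈ O.d Q
  d-cong P≈Q = +-cong (*-cong (P≈Q zero) (P≈Q zero)) (*-cong (P≈Q (suc zero)) (P≈Q (suc zero)))

  d-symmetric : ∀ P Q → O.d (O._⊖_ P Q) ≈ O.d (O._⊖_ Q P)
  d-symmetric P Q = solve 4 (λ x y x′ y′ →
    (x :+ :- x′) :* (x :+ :- x′) :+ (y :+ :- y′) :* (y :+ :- y′) :=
    (x′ :+ :- x) :* (x′ :+ :- x) :+ (y′ :+ :- y) :* (y′ :+ :- y)) refl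
    (P zero) (P (suc zero)) (Q zero) (Q (suc zero))
    where open Solver

-- Differentiating an equivalence along a generic realisation

module Infinitesimal (K : Domain) where
  open Domain K
  open Over rawRing ι
    using (eval; Point; _⊖_; d; Realisation; Generic; Equivalent; AlgebraicallyIndependent)
  open Tangents K
  open Geometry K
  open Solver
  private
    module E  = ℚAlgebra (dual algebra)
    module EK = Evaluation algebra
    module EE = Evaluation (dual algebra)
    module OE = Over E.rawRing E.ι

  -- Each extension multiplies all earlier velocities by its own scalar, so the product of the
  -- scalars is carried along.
  extendAll : ∀ {k} m (zs : Vector Carrier m) (X : Vector E.Carrier k) → Tangent X →
    ¬ ¬ ∃ λ l → ¬ (l ≈ 0#) × Σ (Vector E.Carrier (m ℕ.+ k)) λ Y → Tangent Y ×
      (∀ i → proj₁ (Y (i ↑ˡ k)) ≈ zs i) × (∀ j → Y (m ↑ʳ j) E.≈ scale₂ l (X j))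
  extendAll zero zs X tangent = ¬¬-η
    (1# , 1≉0 , X , tangent , (λ ()) , λ j → refl , sym (*-identityˡ _))
  extendAll (suc m) zs X tangent =
    extendAll m (zs ∘ suc) X tangent >>= λ (l , l≉0 , Y , tangentY , left , right) →
    Extension.extend Y tangentY (zs zero) >>= λ (l′ , l′≉0 , z′ , tangent′) →
    ¬¬-η (l′ * l , *-≉0 l′≉0 l≉0 , (zs zero , z′) Vector.∷ (scale₂ l′ ∘ Y) , tangent′
      , (λ { zero → refl ; (suc i) → left i })
      , λ j → let (eq₁ , eq₂) = right j in
          eq₁ , trans (*-congˡ eq₂) (sym (*-assoc l′ l _)))

  -- For an edge, d (p a - p b) - d (q a - q b) is a polynomial vanishing at (q , p); a tangent
  -- vector there annihilates its derivative as well.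
  infinitesimalEquivalence : ∀ {n} (G : Graph n) (p q : Realisation n) → Generic p →
    Equivalent G p q → (δ : Realisation n) →
    ¬ ¬ ∃ λ l → ¬ (l ≈ 0#) × Σ (Realisation n) λ δ′ → ∀ a b → Graph._~_ G a b →
      (q a ⊖ q b) · (δ′ a ⊖ δ′ b) ≈ l * ((p a ⊖ p b) · (δ a ⊖ δ b))
  infinitesimalEquivalence {n} G p q generic equiv δ =
    extendAll k (Vector.concat q) X₀ (generic⇒tangent generic) >>= λ (l , l≉0 , X , t , left , right) →
      ¬¬-η (l , l≉0 , (λ w i → proj₂ (X (combine w i ↑ˡ k))) , edge l X t left right)
    where
    k = n ℕ.* 2
    m = k ℕ.+ k

    X₀ : Vector E.Carrier k
    X₀ j = Vector.concat p j , Vector.concat δ j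

    module _ (l : Carrier) (X : Vector E.Carrier m) (t : Tangent X)
      (left  : ∀ i → proj₁ (X (i ↑ˡ k)) ≈ Vector.concat q i)
      (right : ∀ j → X (k ↑ʳ j) E.≈ scale₂ l (X₀ j)) where

      open PolynomialGeometry m using () renaming (Point to Pointᴾ; _⊖_ to _⊖ᴾ_; d to dᴾ)

      -- `extendAll` puts new coordinates in front, so those of `q` precede those of `p`.
      pᴾ qᴾ : Fin n → Pointᴾ
      pᴾ w i = varᴾ (k ↑ʳ combine w i)
      qᴾ w i = varᴾ (combine w i ↑ˡ k)

      pᴱ qᴱ : Fin n → OE.Point
      pᴱ w i = p w i , l * δ w i
      qᴱ w i = q w i , proj₂ (X (combine w i ↑ˡ k))

      eval-p : ∀ w i → evalᴱ m (pᴾ w i) X E.≈ pᴱ w i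
      eval-p w i = E.trans (EE.eval-var (k ↑ʳ combine w i) X) (E.trans (right (combine w i))
        (reflexive (concat-combine p w i) , *-congˡ (reflexive (concat-combine δ w i))))

      eval-q : ∀ w i → evalᴱ m (qᴾ w i) X E.≈ qᴱ w i
      eval-q w i = E.trans (EE.eval-var (combine w i ↑ˡ k) X)
        (trans (left (combine w i)) (reflexive (concat-combine q w i)) , refl)

      eval-distance : ∀ (xᴾ : Fin n → Pointᴾ) (xᴱ : Fin n → OE.Point) →
        (∀ w i → evalᴱ m (xᴾ w i) X E.≈ xᴱ w i) → ∀ a b →
        evalᴱ m (dᴾ (xᴾ a ⊖ᴾ xᴾ b)) X E.≈ OE.d (OE._⊖_ (xᴱ a) (xᴱ b))
      eval-distance xᴾ xᴱ eval-x a b = E.trans (eval-d (dual algebra) m (xᴾ a ⊖ᴾ xᴾ b) X)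
        (d-cong (dual algebra) λ i → E.trans (eval-⊖ (dual algebra) m (xᴾ a) (xᴾ b) X i)
          (E.+-cong (eval-x a i) (E.-‿cong (eval-x b i))))

      edge : ∀ a b → Graph._~_ G a b →
        (q a ⊖ q b) · ((λ i → proj₂ (X (combine a i ↑ˡ k))) ⊖ (λ i → proj₂ (X (combine b i ↑ˡ k))))
        ≈ l * ((p a ⊖ p b) · (δ a ⊖ δ b))
      -- The derivative of a sum of squares is twice a scalar product; `x+x≈0⇒x≈0` removes the
      -- factor.
      edge a b a~b = sym (x∙y⁻¹≈ε⇒x≈y _ _ (x+x≈0⇒x≈0 (trans (solve 13
          (λ l x₀ x₁ u₀ u₁ u₀′ u₁′ y₀ y₁ v₀ v₁ v₀′ v₁′ →
             let r = l :* (x₀ :* (u₀ :+ :- u₀′) :+ x₁ :* (u₁ :+ :- u₁′))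
                     :+ :- (y₀ :* (v₀ :+ :- v₀′) :+ y₁ :* (v₁ :+ :- v₁′))
                 twice = λ x s → x :* s :+ s :* x
             in r :+ r :=
               (twice x₀ (l :* u₀ :+ :- (l :* u₀′)) :+ twice x₁ (l :* u₁ :+ :- (l :* u₁′)))
               :+ :- (twice y₀ (v₀ :+ :- v₀′) :+ twice y₁ (v₁ :+ :- v₁′)))
          refl l _ _ _ _ _ _ _ _ _ _ _ _)
        (trans (sym (proj₂ eval-relation)) (t relation value≈0)))))
        where
        relation : Poly m
        relation = addᴾ m (dᴾ (pᴾ a ⊖ᴾ pᴾ b)) (negᴾ m (dᴾ (qᴾ a ⊖ᴾ qᴾ b)))

        eval-relation : evalᴱ m relation X E.≈
          OE.d (OE._⊖_ (pᴱ a) (pᴱ b)) E.+ E.- OE.d (OE._⊖_ (qᴱ a) (qᴱ b))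
        eval-relation = E.trans (EE.eval-add m (dᴾ (pᴾ a ⊖ᴾ pᴾ b)) (negᴾ m (dᴾ (qᴾ a ⊖ᴾ qᴾ b))) X)
          (E.+-cong (eval-distance pᴾ pᴱ eval-p a b)
            (E.trans (EE.eval-neg m (dᴾ (qᴾ a ⊖ᴾ qᴾ b)) X)
                     (E.-‿cong (eval-distance qᴾ qᴱ eval-q a b))))

        value≈0 : proj₁ (evalᴱ m relation X) ≈ 0#
        value≈0 = trans (proj₁ eval-relation) (x≈y⇒x∙y⁻¹≈ε (equiv a b a~b))

  -- Otherwise the determinant would be a zero polynomial and vanish at every realisation, yet it is
  -- 1 when a, b, c are placed at 0, `e₀`, `e₁`.
  generic⇒noncollinear : ∀ {n} (p : Realisation n) → Generic p → ∀ {a b c} →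
    a ≢ b → a ≢ c → b ≢ c → ¬ (det (p a ⊖ p b) (p a ⊖ p c) ≈ 0#)
  generic⇒noncollinear {n} p generic {a} {b} {c} a≢b a≢c b≢c det≈0 = 1≉0 (begin
    1#
      ≈⟨ solve 0 (con 1ℚ := (con 0ℚ :+ :- con 1ℚ) :* (con 0ℚ :+ :- con 1ℚ)
           :+ :- ((con 0ℚ :+ :- con 0ℚ) :* (con 0ℚ :+ :- con 0ℚ))) refl ⟩
    det (origin ⊖ e₀) (origin ⊖ e₁)
      ≡⟨ ≡.cong₂ det (≡.cong₂ _⊖_ at-a at-b) (≡.cong₂ _⊖_ at-a at-c) ⟨
    det (r a ⊖ r b) (r a ⊖ r c)
      ≈⟨ eval-noncollinear r ⟨
    eval k polynomial (Vector.concat r)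
      ≈⟨ EK.isZero⇒eval≈0 k (generic polynomial (trans (eval-noncollinear p) det≈0)) (Vector.concat r) ⟩
    0# ∎)
    where
    k = n ℕ.* 2
    open PolynomialGeometry k using (detᴾ) renaming (Point to Pointᴾ; _⊖_ to _⊖ᴾ_)

    X : Fin n → Pointᴾ
    X w i = varᴾ (combine w i)

    polynomial : Poly k
    polynomial = detᴾ (X a ⊖ᴾ X b) (X a ⊖ᴾ X c)

    eval-difference : ∀ (x : Realisation n) u v i →
      eval k ((X u ⊖ᴾ X v) i) (Vector.concat x) ≈ (x u ⊖ x v) i
    eval-difference x u v i = trans (eval-⊖ algebra k (X u) (X v) (Vector.concat x) i)
      (+-cong (coordinate u) (-‿cong (coordinate v)))
      where
      coordinate : ∀ w → eval k (X w i) (Vector.concat x) ≈ x w i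
      coordinate w = trans (EK.eval-var (combine w i) (Vector.concat x))
        (reflexive (concat-combine x w i))

    eval-noncollinear : ∀ (x : Realisation n) →
      eval k polynomial (Vector.concat x) ≈ det (x a ⊖ x b) (x a ⊖ x c)
    eval-noncollinear x = trans (EK.eval-add k _ _ (Vector.concat x)) (+-cong
      (product zero (suc zero))
      (trans (EK.eval-neg k _ (Vector.concat x)) (-‿cong (product (suc zero) zero))))
      where
      product : ∀ i j → eval k (mulᴾ k ((X a ⊖ᴾ X b) i) ((X a ⊖ᴾ X c) j)) (Vector.concat x)
        ≈ (x a ⊖ x b) i * (x a ⊖ x c) j
      product i j = trans (EK.eval-mul k _ _ (Vector.concat x))
        (*-cong (eval-difference x a b i) (eval-difference x a c j))

    origin : Point
    origin _ = 0#

    r : Realisation n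
    r w = if does (w Fin.≟ b) then e₀ else if does (w Fin.≟ c) then e₁ else origin

    at-a : r a ≡ origin
    at-a with a Fin.≟ b | a Fin.≟ c
    ... | yes a≡b | _       = ⊥-elim (a≢b a≡b)
    ... | no _    | yes a≡c = ⊥-elim (a≢c a≡c)
    ... | no _    | no _    = ≡.refl

    at-b : r b ≡ e₀
    at-b with b Fin.≟ b
    ... | yes _  = ≡.refl
    ... | no b≢b = ⊥-elim (b≢b ≡.refl)

    at-c : r c ≡ e₁
    at-c with c Fin.≟ b | c Fin.≟ c
    ... | yes c≡b | _      = ⊥-elim (b≢c (≡.sym c≡b))
    ... | no _    | yes _  = ≡.refl
    ... | no _    | no c≢c = ⊥-elim (c≢c ≡.refl)

-- The rigidity matrix as functionals, and trivial flexes

module Rigidity (K : Domain) where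
  open Domain K
  open Over rawRing ι using (Point; _⊖_; Realisation)
  open Geometry K
  open LinearAlgebra K
  open Solver

  unflatten : ∀ {n} → Vector Carrier (n ℕ.* 2) → Realisation n
  unflatten x w i = x (combine w i)

  -- The row of the rigidity matrix belonging to the edge e, as a functional.
  stretch : ∀ {n} → Realisation n → Fin n × Fin n → Vector Carrier (n ℕ.* 2) → Carrier
  stretch p (u , v) x = (p u ⊖ p v) · (unflatten x u ⊖ unflatten x v)

  stretch-isLinear : ∀ {n} (p : Realisation n) e → IsLinear (stretch p e)
  stretch-isLinear p e = record
    { +-homo = λ x y → solve 10 (λ x₀ x₁ a b c d a′ b′ c′ d′ →
        x₀ :* ((a :+ a′) :+ :- (b :+ b′)) :+ x₁ :* ((c :+ c′) :+ :- (d :+ d′)) :=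
        (x₀ :* (a :+ :- b) :+ x₁ :* (c :+ :- d)) :+ (x₀ :* (a′ :+ :- b′) :+ x₁ :* (c′ :+ :- d′)))
        refl _ _ _ _ _ _ _ _ _ _
    ; *-homo = λ k x → solve 7 (λ x₀ x₁ a b c d k →
        x₀ :* (k :* a :+ :- (k :* b)) :+ x₁ :* (k :* c :+ :- (k :* d)) :=
        k :* (x₀ :* (a :+ :- b) :+ x₁ :* (c :+ :- d))) refl _ _ _ _ _ _ _
    ; 0-homo = solve 2 (λ x₀ x₁ → x₀ :* (con 0ℚ :+ :- con 0ℚ) :+ x₁ :* (con 0ℚ :+ :- con 0ℚ)
        := con 0ℚ) refl _ _
    }

  ·-cong : ∀ {P P′ Q Q′} → (∀ i → P i ≈ P′ i) → (∀ i → Q i ≈ Q′ i) → P · Q ≈ P′ · Q′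
  ·-cong P≈ Q≈ = +-cong (*-cong (P≈ zero) (Q≈ zero)) (*-cong (P≈ (suc zero)) (Q≈ (suc zero)))

  ⊖-cong : ∀ {P P′ Q Q′ : Point} → (∀ i → P i ≈ P′ i) → (∀ i → Q i ≈ Q′ i) →
    ∀ i → (P ⊖ Q) i ≈ (P′ ⊖ Q′) i
  ⊖-cong P≈ Q≈ i = +-cong (P≈ i) (-‿cong (Q≈ i))

  stretch-cong : ∀ {n} {p p′ : Realisation n} (e : Fin n × Fin n) {x x′} →
    (∀ w i → p w i ≈ p′ w i) → (∀ j → x j ≈ x′ j) → stretch p e x ≈ stretch p′ e x′
  stretch-cong {p = p} {p′} (u , v) {x} {x′} p≈ x≈ =
    ·-cong {p u ⊖ p v} {p′ u ⊖ p′ v} {unflatten x u ⊖ unflatten x v}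
      (⊖-cong {p u} {p′ u} {p v} (p≈ u) (p≈ v))
      (⊖-cong {unflatten x u} {unflatten x′ u} {unflatten x v}
        (λ i → x≈ (combine u i)) (λ i → x≈ (combine v i)))

  stretch-unflatten : ∀ {n} (p : Realisation n) u v x {P Q : Point} →
    (∀ i → x (combine u i) ≈ P i) → (∀ i → x (combine v i) ≈ Q i) →
    stretch p (u , v) x ≈ (p u ⊖ p v) · (P ⊖ Q)
  stretch-unflatten p u v x {P} {Q} P≈ Q≈ =
    ·-cong {p u ⊖ p v} {p u ⊖ p v} {unflatten x u ⊖ unflatten x v} (λ _ → refl)
      (⊖-cong {unflatten x u} {P} {unflatten x v} P≈ Q≈)

  stretch-concat : ∀ {n} (p : Realisation n) u v (x : Realisation n) →
    stretch p (u , v) (Vector.concat x) ≈ (p u ⊖ p v) · (x u ⊖ x v)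
  stretch-concat p u v x = stretch-unflatten p u v (Vector.concat x)
    (λ i → reflexive (concat-combine x u i)) (λ i → reflexive (concat-combine x v i))

  -- The pairs of vertices e are independent at p, as witnessed by a dual
  -- system of motions, each stretching exactly one of the pairs.
  record DualMotions {n r} (p : Realisation n) (e : Fin r → Fin n × Fin n) : Set where
    field
      motion   : Fin r → Realisation n
      diagonal : ∀ a → ¬ (stretch p (e a) (Vector.concat (motion a)) ≈ 0#)
      off      : ∀ a b → a ≢ b → stretch p (e a) (Vector.concat (motion b)) ≈ 0#

  rotate : Point → Point
  rotate P = (- P (suc zero)) Vector.∷ P zero Vector.∷ Vector.[]

  record Trivial {n} (q η : Realisation n) : Set where
    field
      scalar      : Carrier
      scalar≉0    : ¬ (scalar ≈ 0#)
      translation : Point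
      angle       : Carrier
      equation    : ∀ w i → scalar * η w i + (translation i + angle * rotate (q w) i) ≈ 0#

  private
    dependent-≡ : ∀ {k m} → k ≡ suc m → (v : Vector (Vector Carrier m) k) → ¬ ¬ Dependent v
    dependent-≡ ≡.refl = dependent

  -- Counting dimensions: the r = 2n - 3 dual motions, the three trivial
  -- motions and η are linearly dependent.
  trivial : ∀ {n r} (q : Realisation n) {e : Fin r → Fin n × Fin n} → r ℕ.+ 3 ≡ 2 ℕ.* n → Fin r →
    DualMotions q e → (η : Realisation n) → (∀ a → stretch q (e a) (Vector.concat η) ≈ 0#) →
    ¬ ¬ Trivial q η
  trivial {n} {r} q {e} count a₀ dual η η-flex =
    -- There are 4 + r vectors for 2n = r + 3 coordinates, one more than fits.
    dependent-≡ (≡.trans (≡.cong suc (≡.trans (ℕ.+-comm 3 r) count)) (≡.cong suc (ℕ.*-comm 2 n)))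
      (Vector.concat ∘ F) >>= conclude
    where
    open DualMotions dual

    F : Fin (4 ℕ.+ r) → Realisation n
    F zero                        = η
    F (suc zero)                  = λ _ → e₀
    F (suc (suc zero))            = λ _ → e₁
    F (suc (suc (suc zero)))      = rotate ∘ q
    F (suc (suc (suc (suc b))))   = motion b

    constant-flex : ∀ a (P : Point) → stretch q (e a) (Vector.concat {n = n} (λ _ → P)) ≈ 0#
    constant-flex a P = trans (stretch-concat q _ _ (λ _ → P))
      (solve 4 (λ x y u v → x :* (u :+ :- u) :+ y :* (v :+ :- v) := con 0ℚ) refl _ _ _ _)

    F-flex : ∀ a j → suc (suc (suc (suc a))) ≢ j → stretch q (e a) (Vector.concat (F j)) ≈ 0#
    F-flex a zero _ = η-flex a
    F-flex a (suc zero) _ = constant-flex a e₀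
    F-flex a (suc (suc zero)) _ = constant-flex a e₁
    F-flex a (suc (suc (suc zero))) _ = trans (stretch-concat q _ _ (rotate ∘ q))
      (solve 4 (λ x y u v →
        (x :+ :- u) :* (:- y :+ :- (:- v)) :+ (y :+ :- v) :* (x :+ :- u) := con 0ℚ) refl _ _ _ _)
    F-flex a (suc (suc (suc (suc b)))) a≢b = off a b
      (λ a≡b → a≢b (≡.cong (λ c → suc (suc (suc (suc c)))) a≡b))

    module _ (c : Vector Carrier (4 ℕ.+ r))
      (c-eq : ∀ j → sum (λ i → c i * Vector.concat (F i) j) ≈ 0#) where

      -- All members of the family except the dual motion `a` leave the edge `e a` unstretched, so
      -- stretching that edge isolates its coefficient.
      motion-coefficient≈0 : ∀ a → c (suc (suc (suc (suc a)))) ≈ 0#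
      motion-coefficient≈0 a = *-cancel (diagonal a) (begin
        stretch q (e a) (Vector.concat (motion a)) * c i
          ≈⟨ *-comm _ _ ⟩
        c i * stretch q (e a) (Vector.concat (F i))
          ≈⟨ sum-single {f = λ j → c j * stretch q (e a) (Vector.concat (F j))} i (λ j i≢j → y≈0⇒x*y≈0 (F-flex a j i≢j)) ⟨
        sum (λ j → c j * stretch q (e a) (Vector.concat (F j)))
          ≈⟨ IsLinear.sum-homo (stretch-isLinear q (e a)) c (Vector.concat ∘ F) ⟨
        stretch q (e a) (λ k → sum (λ j → c j * Vector.concat (F j) k))
          ≈⟨ stretch-cong {p = q} (e a) (λ _ _ → refl) c-eq ⟩
        stretch q (e a) (λ _ → 0#)
          ≈⟨ IsLinear.0-homo (stretch-isLinear q (e a)) ⟩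
        0# ∎)
        where i = suc (suc (suc (suc a)))

      c₀ = c zero
      c₁ = c (suc zero)
      c₂ = c (suc (suc zero))
      c₃ = c (suc (suc (suc zero)))

      trivial-equation : ∀ w i → c₀ * η w i + (c₁ * e₀ i + (c₂ * e₁ i + c₃ * rotate (q w) i)) ≈ 0#
      trivial-equation w i = trans (+-congˡ (+-congˡ (+-congˡ (sym (trans
          (+-congˡ (sum-zero λ b → x≈0⇒x*y≈0 (motion-coefficient≈0 b)))
          (+-identityʳ _))))))
        (trans (sum-cong-≋ {4 ℕ.+ r} {λ j → c j * F j w i}
                 {λ j → c j * Vector.concat (F j) (combine w i)}
                 λ j → *-congˡ (reflexive (≡.sym (concat-combine (F j) w i))))
               (c-eq (combine w i)))

      equation₀ : ∀ w → c₀ * η w zero + (c₁ + c₃ * (- q w (suc zero))) ≈ 0#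
      equation₀ w = trans (+-congˡ (solve 4 (λ c₁ c₂ c₃ y →
        c₁ :+ c₃ :* y := c₁ :* con 1ℚ :+ (c₂ :* con 0ℚ :+ c₃ :* y)) refl c₁ c₂ c₃ _))
        (trivial-equation w zero)

      equation₁ : ∀ w → c₀ * η w (suc zero) + (c₂ + c₃ * q w zero) ≈ 0#
      equation₁ w = trans (+-congˡ (solve 4 (λ c₁ c₂ c₃ y →
        c₂ :+ c₃ :* y := c₁ :* con 0ℚ :+ (c₂ :* con 1ℚ :+ c₃ :* y)) refl c₁ c₂ c₃ _))
        (trivial-equation w (suc zero))

      module _ (c₀≈0 : c₀ ≈ 0#) where
        u = proj₁ (e a₀)
        v = proj₂ (e a₀)

        rotation₀ : ∀ w → c₁ + c₃ * (- q w (suc zero)) ≈ 0#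
        rotation₀ w = trans (sym (+-identityˡ _))
          (trans (+-congʳ (sym (x≈0⇒x*y≈0 c₀≈0))) (equation₀ w))

        rotation₁ : ∀ w → c₂ + c₃ * q w zero ≈ 0#
        rotation₁ w = trans (sym (+-identityˡ _))
          (trans (+-congʳ (sym (x≈0⇒x*y≈0 c₀≈0))) (equation₁ w))

        c₃*difference≈0 : ∀ i → c₃ * (q u ⊖ q v) i ≈ 0#
        c₃*difference≈0 zero = trans
          (solve 4 (λ c c₂ x y → c :* (x :+ :- y) := (c₂ :+ c :* x) :+ :- (c₂ :+ c :* y)) refl
            c₃ c₂ _ _)
          (trans (+-cong (rotation₁ u) (-‿cong (rotation₁ v))) (-‿inverseʳ 0#))
        c₃*difference≈0 (suc zero) = trans
          (solve 4 (λ c c₁ x y → c :* (x :+ :- y) := (c₁ :+ c :* (:- y)) :+ :- (c₁ :+ c :* (:- x)))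
            refl c₃ c₁ _ _)
          (trans (+-cong (rotation₀ v) (-‿cong (rotation₀ u))) (-‿inverseʳ 0#))

        c₃≈0 : c₃ ≈ 0#
        -- A nonzero c₃ would make the ends of the edge `a₀` coincide in `q`, and then no motion
        -- could stretch it; hence the argument `Fin r`.
        c₃≈0 = stable λ c₃≉0 → diagonal a₀ (x≈0×y≈0⇒x+y≈0
          (x≈0⇒x*y≈0 (*-cancel c₃≉0 (c₃*difference≈0 zero)))
          (x≈0⇒x*y≈0 (*-cancel c₃≉0 (c₃*difference≈0 (suc zero)))))

        all≈0 : ∀ i → c i ≈ 0#
        all≈0 zero = c₀≈0
        all≈0 (suc zero) = trans (sym (+-identityʳ _))
          (trans (+-congˡ (sym (x≈0⇒x*y≈0 c₃≈0))) (rotation₀ u))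
        all≈0 (suc (suc zero)) = trans (sym (+-identityʳ _))
          (trans (+-congˡ (sym (x≈0⇒x*y≈0 c₃≈0))) (rotation₁ u))
        all≈0 (suc (suc (suc zero))) = c₃≈0
        all≈0 (suc (suc (suc (suc a)))) = motion-coefficient≈0 a

    conclude : Dependent (Vector.concat ∘ F) → ¬ ¬ Trivial q η
    conclude (c , (i , ci≉0) , c-eq) = ¬¬-η record
      { scalar      = c zero
      ; scalar≉0    = λ c₀≈0 → ci≉0 (all≈0 c c-eq c₀≈0 i)
      ; translation = c (suc zero) Vector.∷ c (suc (suc zero)) Vector.∷ Vector.[]
      ; angle       = c (suc (suc (suc zero)))
      ; equation    = λ { w zero → equation₀ c c-eq w ; w (suc zero) → equation₁ c c-eq w }
      }

  unit-combine : ∀ {n} (w u : Fin n) (k i : Fin 2) → unit (combine w k) (combine u i) ≡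
    (if does (w Fin.≟ u) then (if does (k Fin.≟ i) then 1# else 0#) else 0#)
  unit-combine w u k i with combine w k Fin.≟ combine u i | w Fin.≟ u | k Fin.≟ i
  ... | yes _  | yes _  | yes _  = ≡.refl
  ... | yes eq | yes _  | no k≢i = ⊥-elim (k≢i (proj₂ (Fin.combine-injective w k u i eq)))
  ... | yes eq | no w≢u | _      = ⊥-elim (w≢u (proj₁ (Fin.combine-injective w k u i eq)))
  ... | no neq | yes eq | yes eq′ = ⊥-elim (neq (≡.cong₂ combine eq eq′))
  ... | no _   | yes _  | no _   = ≡.refl
  ... | no _   | no _   | _      = ≡.refl

  row : ∀ {n} → Realisation n → Fin n × Fin n → Vector Carrier (n ℕ.* 2)
  row p (u , v) = Vector.concat λ w →
    if does (w Fin.≟ u) then p u ⊖ p v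
    else if does (w Fin.≟ v) then p v ⊖ p u
    else λ _ → 0#

  -- Links the functionals to the matrix rows in which rank is defined.
  stretch-unit : ∀ {n} (p : Realisation n) {u v} → u ≢ v → ∀ j →
    stretch p (u , v) (unit j) ≈ row p (u , v) j
  stretch-unit {n} p {u} {v} u≢v j = ≡.subst
    (λ j → stretch p (u , v) (unit j) ≈ row p (u , v) j) (Fin.combine-remQuot {n} 2 j)
    (at-combine (proj₁ (remQuot {n} 2 j)) (proj₂ (remQuot {n} 2 j)))
    where
    indicator : Fin n → Fin 2 → Fin n → Point
    indicator w k a i = if does (w Fin.≟ a) then (if does (k Fin.≟ i) then 1# else 0#) else 0#

    entry : Fin n → Point
    entry w = if does (w Fin.≟ u) then p u ⊖ p v
              else if does (w Fin.≟ v) then p v ⊖ p u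
              else λ _ → 0#

    by-cases : ∀ w k → (p u ⊖ p v) · (indicator w k u ⊖ indicator w k v) ≈ entry w k
    by-cases w k with w Fin.≟ u | w Fin.≟ v
    by-cases w k | yes ≡.refl | yes ≡.refl = ⊥-elim (u≢v ≡.refl)
    by-cases w zero | yes _ | no _ = solve 2 (λ x y →
      x :* (con 1ℚ :+ :- con 0ℚ) :+ y :* (con 0ℚ :+ :- con 0ℚ) := x) refl _ _
    by-cases w (suc zero) | yes _ | no _ = solve 2 (λ x y →
      x :* (con 0ℚ :+ :- con 0ℚ) :+ y :* (con 1ℚ :+ :- con 0ℚ) := y) refl _ _
    by-cases w zero | no _ | yes _ = solve 3 (λ x x′ y →
      (x :+ :- x′) :* (con 0ℚ :+ :- con 1ℚ) :+ y :* (con 0ℚ :+ :- con 0ℚ) := x′ :+ :- x) refl _ _ _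
    by-cases w (suc zero) | no _ | yes _ = solve 3 (λ x y y′ →
      x :* (con 0ℚ :+ :- con 0ℚ) :+ (y :+ :- y′) :* (con 0ℚ :+ :- con 1ℚ) := y′ :+ :- y) refl _ _ _
    by-cases w k | no _ | no _ = solve 2 (λ x y →
      x :* (con 0ℚ :+ :- con 0ℚ) :+ y :* (con 0ℚ :+ :- con 0ℚ) := con 0ℚ) refl _ _

    at-combine : ∀ w k → stretch p (u , v) (unit (combine w k)) ≈ row p (u , v) (combine w k)
    at-combine w k = trans
      (stretch-unflatten p u v (unit (combine w k))
        (λ i → reflexive (unit-combine w u k i)) (λ i → reflexive (unit-combine w v k i)))
      (trans (by-cases w k) (reflexive (≡.sym (concat-combine entry w k))))

-- Transferring independence of rows between generic points

module PolynomialDomain (K : Domain) {k : ℕ} (x : Vector (Domain.Carrier K) k) where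
  open Domain K
  open Evaluation algebra

  -- ℚ[x], with polynomials as names for its elements.
  evaluatedRawRing : RawRing 0ℓ 0ℓ
  evaluatedRawRing = record (polyRawRing k) { _≈_ = λ P Q → eval k P x ≈ eval k Q x }

  private
    eval-isMonomorphism :
      RingMorphisms.IsRingMonomorphism evaluatedRawRing rawRing (λ P → eval k P x)
    eval-isMonomorphism = record
      { isRingHomomorphism = record
        { isSemiringHomomorphism = record
          { isNearSemiringHomomorphism = record
            { +-isMonoidHomomorphism = record
              { isMagmaHomomorphism = record
                { isRelHomomorphism = record { cong = id }
                ; homo = λ P Q → eval-add k P Q x
                }
              ; ε-homo = trans (eval-const k 0ℚ x) ι.0#-homo
              }
            ; *-homo = λ P Q → eval-mul k P Q x
            }
          ; 1#-homo = trans (eval-const k 1ℚ x) ι.1#-homo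
          }
        ; -‿homo = λ P → eval-neg k P x
        }
      ; injective = id
      }

    eval-0 : eval k (constᴾ k 0ℚ) x ≈ 0#
    eval-0 = trans (eval-const k 0ℚ x) ι.0#-homo

  polynomialDomain : Domain
  polynomialDomain = record
    { algebra = record
      { commutativeRing = record
        { isCommutativeRing =
            RingMonomorphism.isCommutativeRing eval-isMonomorphism isCommutativeRing }
      ; ι = constᴾ k
      ; ι-hom = record
        { isSemiringHomomorphism = record
          { isNearSemiringHomomorphism = record
            { +-isMonoidHomomorphism = record
              { isMagmaHomomorphism = record
                { isRelHomomorphism = record { cong = λ { ≡.refl → refl } }
                ; homo = λ p q → trans (eval-const k (p ℚ.+ q) x) (trans (ι.+-homo p q)
                    (sym (trans (eval-add k (constᴾ k p) (constᴾ k q) x)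
                      (+-cong (eval-const k p x) (eval-const k q x)))))
                }
              ; ε-homo = refl
              }
            ; *-homo = λ p q → trans (eval-const k (p ℚ.* q) x) (trans (ι.*-homo p q)
                (sym (trans (eval-mul k (constᴾ k p) (constᴾ k q) x)
                  (*-cong (eval-const k p x) (eval-const k q x)))))
            }
          ; 1#-homo = refl
          }
        ; -‿homo = λ p → trans (eval-const k (ℚ.- p) x) (trans (ι.-‿homo p)
            (sym (trans (eval-neg k (constᴾ k p) x) (-‿cong (eval-const k p x)))))
        }
      }
    ; stable      = stable
    ; *-cancel    = λ {P} {Q} P≉0 PQ≈0 → trans
        (*-cancel (λ P≈0 → P≉0 (trans P≈0 (sym eval-0)))
          (trans (sym (eval-mul k P Q x)) (trans PQ≈0 eval-0)))
        (sym eval-0)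
    ; ι-injective = λ {q} q≈0 →
        ι-injective (trans (sym (eval-const k q x)) (trans q≈0 eval-0))
    }

module Specialisation (K L : Domain) where
  private
    module K = Domain K
    module L = Domain L
    module OK = Over K.rawRing K.ι
    module OL = Over L.rawRing L.ι
    module EK = Evaluation K.algebra
    module EL = Evaluation L.algebra

  specialise : ∀ {k x} → OK.AlgebraicallyIndependent x → ∀ P Q →
    OK.eval k P x K.≈ OK.eval k Q x → ∀ y → OL.eval k P y L.≈ OL.eval k Q y
  specialise {k} {x} indep P Q P≈Q y = L.x∙y⁻¹≈ε⇒x≈y _ _ (L.trans
    (L.sym (L.trans (EL.eval-add k P (negᴾ k Q) y) (L.+-congˡ (EL.eval-neg k Q y))))
    (EL.isZero⇒eval≈0 k (indep (addᴾ k P (negᴾ k Q)) (K.trans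
      (K.trans (EK.eval-add k P (negᴾ k Q) x) (K.+-congˡ (EK.eval-neg k Q x)))
      (K.x≈y⇒x∙y⁻¹≈ε P≈Q))) y))

  -- A polynomial in the subfamily becomes one in the whole family by renaming variables, so
  -- independence of the whole family applies to it.
  specialise-subfamily : ∀ {k l x} → OK.AlgebraicallyIndependent x → (f : Fin k → Fin l) → ∀ P →
    OK.eval k P (x ∘ f) K.≈ K.0# → ∀ y → OL.eval k P (y ∘ f) L.≈ L.0#
  specialise-subfamily {k} {l} {x} indep f P P≈0 y = L.trans
    (L.sym (IsEvaluationHom.eval-natural (eval-isEvaluationHom L.algebra l y) k P
      (λ i → EL.eval-var (f i) y)))
    (EL.isZero⇒eval≈0 l (indep renamed (K.trans
      (IsEvaluationHom.eval-natural (eval-isEvaluationHom K.algebra l x) k P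
        (λ i → EK.eval-var (f i) x)) P≈0)) y)
    where
    renamed : Poly l
    renamed = Over.eval (polyRawRing l) (constᴾ l) k P (varᴾ ∘ f)

edge-lookup : ∀ {n} (H : Graph n) i → let (u , v) = List.lookup (edges H) i in Graph._~_ H u v
edge-lookup {n} H i = proj₂ (All.lookup
  (All.all-filter (λ e → proj₁ e Fin.<? proj₂ e ×-dec Graph.~-dec H (proj₁ e) (proj₂ e))
    (List.cartesianProduct (List.allFin n) (List.allFin n)))
  (∈-lookup {xs = edges H} i))

module _ (K L : Domain) where
  private
    module K = Domain K
    module L = Domain L
    module OK = Over K.rawRing K.ι
    module OL = Over L.rawRing L.ι
    module RK = Rigidity K
    module RL = Rigidity L

  module _ {n r} (H : Graph n) (p′ : OL.Realisation n) (generic : OL.Generic p′)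
    (s : Fin r → Fin (length (edges H)))
    (independent : OL.LinearlyIndependent (OL.rigidityMatrix H p′ ∘ s))
    (p : OK.Realisation n)
    (vanishing : ∀ P → OK.eval (n ℕ.* 2) P (Vector.concat p) K.≈ K.0# →
      OL.eval (n ℕ.* 2) P (Vector.concat p′) L.≈ L.0#) where

    private
      k = n ℕ.* 2
      x′ = Vector.concat p′
      x  = Vector.concat p
      𝔻 = PolynomialDomain.polynomialDomain L x′

      module D  = Domain 𝔻
      module RD = Rigidity 𝔻
      module LD = LinearAlgebra 𝔻
      module LL = LinearAlgebra L
      module EL = Evaluation L.algebra

      e : Fin r → Fin n × Fin n
      e a = List.lookup (edges H) (s a)

      X : Over.Realisation D.rawRing D.ι n
      X w i = varᴾ (combine w i)

      module _ (M : Domain) where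
        open Domain M
        open Evaluation algebra
        open Rigidity M using (stretch; stretch-cong)

        eval-stretch : ∀ (q : Over.Realisation rawRing ι n) edge (y : Vector (Poly k) k) →
          eval k (RD.stretch X edge y) (Vector.concat q)
            ≈ stretch q edge (λ j → eval k (y j) (Vector.concat q))
        eval-stretch q edge@(u , v) y = trans (trans (eval-add k _ _ z) (+-cong
            (trans (eval-mul k _ _ z) (*-cong (difference X zero) (difference (RD.unflatten y) zero)))
            (trans (eval-mul k _ _ z)
              (*-cong (difference X (suc zero)) (difference (RD.unflatten y) (suc zero))))))
          (stretch-cong edge {λ j → eval k (y j) z} (λ w i → trans (eval-var (combine w i) z)
            (reflexive (concat-combine q w i))) (λ _ → refl))
          where
          z = Vector.concat q
          difference : ∀ (Y : Fin n → Vector (Poly k) 2) i →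
            eval k (addᴾ k (Y u i) (negᴾ k (Y v i))) z ≈ eval k (Y u i) z + - eval k (Y v i) z
          difference Y i = eval-⊖ algebra k (Y u) (Y v) z i

        eval-sum : ∀ {m} (f : Vector (Poly k) m) z → eval k (D.sum f) z ≈ sum (λ i → eval k (f i) z)
        eval-sum {zero}  f z = trans (eval-const k 0ℚ z) ι.0#-homo
        eval-sum {suc m} f z = trans (eval-add k _ _ z) (+-congˡ (eval-sum (f ∘ suc) z))

      eval-unit : ∀ (j i : Fin k) → OL.eval k (LD.unit {k} j i) x′ L.≈ LL.unit {k} j i
      eval-unit j i with does (j Fin.≟ i)
      ... | true  = L.trans (EL.eval-const k 1ℚ x′) L.ι.1#-homo
      ... | false = L.trans (EL.eval-const k 0ℚ x′) L.ι.0#-homo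

      eval-row : ∀ a j → OL.eval k (RD.stretch X (e a) (LD.unit {k} j)) x′ L.≈
        OL.rigidityMatrix H p′ (s a) j
      eval-row a j = L.trans (eval-stretch L p′ (e a) (LD.unit j)) (L.trans
        (RL.stretch-cong {p = p′} (e a) {λ i → OL.eval k (LD.unit {k} j i) x′} {LL.unit {k} j}
          (λ _ _ → L.refl) (eval-unit j))
        (RL.stretch-unit p′ (N⇒≢ H (edge-lookup H (s a))) j))

      eval-0 : OL.eval k D.0# x′ L.≈ L.0#
      eval-0 = L.trans (EL.eval-const k 0ℚ x′) L.ι.0#-homo

      -- A dependence over ℚ[p′] evaluates to a real one between the selected rows of the rigidity
      -- matrix.
      ¬dependent : ¬ LD.Dependent (λ a j → RD.stretch X (e a) (LD.unit j))
      ¬dependent (c , (i , ci≉0) , eq) = ci≉0 (L.trans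
        (independent (λ a → OL.eval k (c a) x′) (λ j → L.trans
          (L.sym (L.trans (eval-sum L (λ a → c a D.* RD.stretch X (e a) (LD.unit j)) x′)
            (L.sum-cong-≋ {r}
              {λ a → OL.eval k (c a D.* RD.stretch X (e a) (LD.unit j)) x′}
              {λ a → OL.eval k (c a) x′ L.* OL.rigidityMatrix H p′ (s a) j}
              (λ a → L.trans (EL.eval-mul k (c a) _ x′) (L.*-congˡ (eval-row a j))))))
          (L.trans (eq j) eval-0)) i)
        (L.sym eval-0))

    -- Elimination takes place in ℚ[p′], so that its outcome transfers from the
    -- real point p′ to the complex point p.
    genericDualMotions : ¬ ¬ RK.DualMotions p e
    genericDualMotions =
      LD.rightInverse (λ a → RD.stretch X (e a)) (λ a → RD.stretch-isLinear X (e a)) >>= λ where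
        (inj₁ dependence) → ⊥-elim (¬dependent dependence)
        (inj₂ inverse) → ¬¬-η (dualMotions inverse)
      where
      module EK = Evaluation K.algebra

      dualMotions : LD.RightInverse (λ a → RD.stretch X (e a)) → RK.DualMotions p e
      dualMotions inverse = record
        { motion   = λ b → RK.unflatten (column′ b)
        -- Here the transfer goes back from `p` to `p′`: a scalar that is zero at `p` would be zero
        -- at `p′`.
        ; diagonal = λ a stretch≈0 → scalar≉0 (L.trans
            (vanishing scalar (K.trans (K.sym (transfer a a scalar (diagonal a))) stretch≈0))
            (L.sym eval-0))
        ; off      = λ a b a≢b → K.trans (transfer a b D.0# (off a b a≢b))
            (K.trans (EK.eval-const k 0ℚ x) K.ι.0#-homo)
        }
        where
        open LD.RightInverse inverse

        column′ : Fin r → Vector K.Carrier k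
        column′ b j = OK.eval k (column b j) x

        -- Since `p′` is generic, an identity in ℚ[p′] is one of polynomials and may be evaluated at
        -- `p`.
        transfer : ∀ a b P → RD.stretch X (e a) (column b) D.≈ P →
          RK.stretch p (e a) (Vector.concat (RK.unflatten {n} (column′ b))) K.≈ OK.eval k P x
        transfer a b P eq = K.trans
          (RK.stretch-concat p (proj₁ (e a)) (proj₂ (e a)) (RK.unflatten {n} (column′ b)))
          (K.trans (K.sym (eval-stretch K p (e a) (column b)))
            (Specialisation.specialise L K generic (RD.stretch X (e a) (column b)) P eq x))

  -- Motions of a single vertex in equivalent realisations

  module _ {n} (G : Graph (suc n)) (p q : OK.Realisation (suc n)) (generic : OK.Generic p)
    (equivalent : OK.Equivalent G p q) (z : Fin (suc n)) where
    open K
    open Geometry K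
    open Infinitesimal K
    open Solver using (solve; _:=_; _:+_; _:*_; :-_; con)
    open OK using (_⊖_; d; Point; Realisation)

    private
      p⁻ q⁻ : Realisation n
      p⁻ = p ∘ punchIn z
      q⁻ = q ∘ punchIn z

      extension : Point → Realisation n → Realisation (suc n)
      extension ξ x = Vector.insertAt x z ξ

      Edge : Fin n × Fin n → Set
      Edge (u , v) = Graph._~_ (G - z) u v

      -- A motion of q matching, up to a scalar, the motion of p given by x
      -- on the vertices other than z and by ξ at z.
      record Companion (x : Realisation n) (ξ : Point) : Set where
        field
          scalar   : Carrier
          scalar≉0 : ¬ (scalar ≈ 0#)
          motion   : Realisation n
          motion-z : Point
          on-edges : ∀ e → Edge e →
            RK.stretch q⁻ e (Vector.concat motion) ≈ scalar * RK.stretch p⁻ e (Vector.concat x)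
          at-z     : ∀ w → Graph._~_ G z (punchIn z w) →
            (q z ⊖ q⁻ w) · (motion-z ⊖ motion w) ≈ scalar * ((p z ⊖ p⁻ w) · (ξ ⊖ x w))

      companion : ∀ x ξ → ¬ ¬ Companion x ξ
      companion x ξ =
        infinitesimalEquivalence G p q generic equivalent δ >>= λ (l , l≉0 , δ′ , eq) → ¬¬-η record
          { scalar = l ; scalar≉0 = l≉0 ; motion = δ′ ∘ punchIn z ; motion-z = δ′ z
          ; on-edges = λ (u , v) u~v → trans (RK.stretch-concat q⁻ u v (δ′ ∘ punchIn z))
              (trans (eq (punchIn z u) (punchIn z v) u~v) (*-congˡ (trans
                (reflexive (≡.cong₂ (λ P Q → (p⁻ u ⊖ p⁻ v) · (P ⊖ Q)) (at-punchIn u) (at-punchIn v)))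
                (sym (RK.stretch-concat p⁻ u v x)))))
          ; at-z = λ w z~w → trans (eq z (punchIn z w) z~w) (*-congˡ
              (reflexive (≡.cong₂ (λ P Q → (p z ⊖ p⁻ w) · (P ⊖ Q))
                (insertAt-lookup x z ξ) (at-punchIn w))))
          }
        where
        δ : Realisation (suc n)
        δ = extension ξ x

        at-punchIn : ∀ w → δ (punchIn z w) ≡ x w
        at-punchIn = insertAt-punchIn x z ξ

      -- Passing to companions multiplies each column of the matrix of stretches by a nonzero
      -- scalar, which preserves its diagonal shape. Thus independence of the edges survives at `q`,
      -- however special `q` is.
      companionDualMotions : ∀ {r} {e : Fin r → Fin n × Fin n} → (∀ a → Edge (e a)) →
        RK.DualMotions p⁻ e → ¬ ¬ RK.DualMotions q⁻ e
      companionDualMotions {r} {e} e-edge dual =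
        ¬¬-finite r (λ b → companion (motion b) (λ _ → 0#)) >>= λ c → ¬¬-η record
          { motion   = λ b → Companion.motion (c b)
          ; diagonal = λ a eq → *-≉0 (Companion.scalar≉0 (c a)) (diagonal a)
              (trans (sym (Companion.on-edges (c a) (e a) (e-edge a))) eq)
          ; off      = λ a b a≢b → trans (Companion.on-edges (c b) (e a) (e-edge a))
              (y≈0⇒x*y≈0 (off a b a≢b))
          }
        where open RK.DualMotions dual

      -- The companion of a motion of z alone, corrected by a trivial motion
      -- so as to fix all other vertices.
      record Pinned (ξ : Point) : Set where
        field
          scalar   : Carrier
          scalar≉0 : ¬ (scalar ≈ 0#)
          motion-z : Point
          at-z     : ∀ w → Graph._~_ G z (punchIn z w) →
            (q z ⊖ q⁻ w) · motion-z ≈ scalar * ((p z ⊖ p⁻ w) · ξ)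

      -- Moving z alone in `p` stretches no edge of `G - z`, so the companion restricts to a flex of
      -- `q⁻`, and that flex is trivial.
      pinned : ∀ {r} {e : Fin r → Fin n × Fin n} → r ℕ.+ 3 ≡ 2 ℕ.* n → Fin r →
        (∀ a → Edge (e a)) → RK.DualMotions q⁻ e → ∀ ξ → ¬ ¬ Pinned ξ
      pinned {r} {e} count a₀ e-edge dual ξ =
        companion (λ _ _ → 0#) ξ >>= λ c →
        RK.trivial q⁻ count a₀ dual (Companion.motion c) (λ a →
          trans (Companion.on-edges c (e a) (e-edge a))
          (y≈0⇒x*y≈0 (trans (RK.stretch-concat p⁻ _ _ (λ _ _ → 0#))
            (solve 2 (λ x y → x :* (con 0ℚ :+ :- con 0ℚ) :+ y :* (con 0ℚ :+ :- con 0ℚ) := con 0ℚ)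
              refl _ _)))) >>= λ t →
        ¬¬-η (pin c t)
        where
        pin : (c : Companion (λ _ _ → 0#) ξ) → RK.Trivial q⁻ (Companion.motion c) → Pinned ξ
        pin c t = record
          { scalar   = β * l
          ; scalar≉0 = *-≉0 β≉0 l≉0
          ; motion-z = η
          ; at-z     = λ w z~w → begin
              (q z ⊖ q⁻ w) · η
                -- Rotating at `q⁻ w` instead of `q z` changes the vector by one perpendicular to
                -- their difference.
                ≈⟨ solve 10 (λ β α x y x′ y′ h₀ h₁ t₀ t₁ →
                     (x :+ :- x′) :* (β :* h₀ :+ (t₀ :+ α :* (:- y)))
                     :+ (y :+ :- y′) :* (β :* h₁ :+ (t₁ :+ α :* x)) :=
                     (x :+ :- x′) :* (β :* h₀ :+ (t₀ :+ α :* (:- y′)))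
                     :+ (y :+ :- y′) :* (β :* h₁ :+ (t₁ :+ α :* x′)))
                     refl β α (q z zero) (q z (suc zero)) (q⁻ w zero) (q⁻ w (suc zero))
                     (h zero) (h (suc zero)) (τ zero) (τ (suc zero)) ⟩
              (q z ⊖ q⁻ w) · (λ i → β * h i + (τ i + α * RK.rotate (q⁻ w) i))
                ≈⟨ subtract w zero (suc zero) ⟩
              β * ((q z ⊖ q⁻ w) · (h ⊖ m w))
                ≈⟨ *-congˡ (Companion.at-z c w z~w) ⟩
              β * (l * ((p z ⊖ p⁻ w) · (ξ ⊖ (λ _ → 0#))))
                ≈⟨ solve 6 (λ β l x y u v →
                     β :* (l :* (x :* (u :+ :- con 0ℚ) :+ y :* (v :+ :- con 0ℚ)))
                     := (β :* l) :* (x :* u :+ y :* v)) refl _ _ _ _ _ _ ⟩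
              (β * l) * ((p z ⊖ p⁻ w) · ξ) ∎
          }
          where
          open Companion c using () renaming (scalar to l; scalar≉0 to l≉0; motion to m; motion-z to h)
          open RK.Trivial t using (equation)
            renaming (scalar to β; scalar≉0 to β≉0; angle to α; translation to τ)

          η : Point
          η i = β * h i + (τ i + α * RK.rotate (q z) i)

          -- β * m w + T vanishes by triviality, so T acts as - β * m w.
          subtract : ∀ w i j → let b = q z ⊖ q⁻ w ; T = λ i → τ i + α * RK.rotate (q⁻ w) i in
            b i * (β * h i + T i) + b j * (β * h j + T j)
            ≈ β * (b i * (h i + - m w i) + b j * (h j + - m w j))
          subtract w i j = trans
            (solve 9 (λ x y β h₀ h₁ m₀ m₁ T₀ T₁ →
              x :* (β :* h₀ :+ T₀) :+ y :* (β :* h₁ :+ T₁) :=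
              β :* (x :* (h₀ :+ :- m₀) :+ y :* (h₁ :+ :- m₁))
              :+ (x :* (β :* m₀ :+ T₀) :+ y :* (β :* m₁ :+ T₁)))
              refl _ _ β (h i) (h j) (m w i) (m w j) _ _)
            (trans (+-congˡ (x≈0×y≈0⇒x+y≈0 (y≈0⇒x*y≈0 (equation w i)) (y≈0⇒x*y≈0 (equation w j))))
              (+-identityʳ _))

    module _ (p′ : OL.Realisation n) (generic′ : OL.Generic p′) where

      private
        coordinate : Fin (n ℕ.* 2) → Fin (suc n ℕ.* 2)
        coordinate j = let (w , i) = remQuot {n} 2 j in combine (punchIn z w) i

        vanishing : ∀ P → OK.eval (n ℕ.* 2) P (Vector.concat p⁻) ≈ 0# →
          OL.eval (n ℕ.* 2) P (Vector.concat p′) L.≈ L.0#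
        vanishing P P≈0 = L.trans
          (eval-cong L.algebra (n ℕ.* 2) P {y = Vector.concat p′⁺ ∘ coordinate} λ j → L.reflexive (≡.sym (≡.trans
            (concat-combine p′⁺ (punchIn z (proj₁ (remQuot {n} 2 j))) _)
            (≡.cong (λ P → P (proj₂ (remQuot {n} 2 j)))
              (insertAt-punchIn p′ z (λ _ → L.0#) (proj₁ (remQuot {n} 2 j)))))))
          (Specialisation.specialise-subfamily K L {x = Vector.concat p} generic coordinate P
            (trans (eval-cong algebra (n ℕ.* 2) P {Vector.concat p ∘ coordinate} λ j → reflexive
              (concat-combine p (punchIn z (proj₁ (remQuot {n} 2 j))) _)) P≈0)
            (Vector.concat p′⁺))
          where
          p′⁺ : OL.Realisation (suc n)
          p′⁺ = Vector.insertAt p′ z (λ _ → L.0#)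

      neighbours-distance : ∀ {r} (s : Fin r → Fin (length (edges (G - z)))) →
        OL.LinearlyIndependent (OL.rigidityMatrix (G - z) p′ ∘ s) → r ℕ.+ 3 ≡ 2 ℕ.* n →
        ∀ (w : Fin 3 → Fin n) → (∀ {i j} → i ≢ j → w i ≢ w j) →
        (∀ i → Graph._~_ G z (punchIn z (w i))) →
        d (p⁻ (w zero) ⊖ p⁻ (w (suc zero))) ≈ d (q⁻ (w zero) ⊖ q⁻ (w (suc zero)))
      neighbours-distance {zero} s independent count =
        -- 3 = 2n is impossible by parity, so some edge is available as `a₀`.
        ⊥-elim (from-no (2 ∣? 3) (divides n (≡.trans count (ℕ.*-comm 2 n))))
      neighbours-distance {suc r} s independent count w w-injective adjacent = stable
        (genericDualMotions (G - z) p′ generic′ s independent p⁻ vanishing >>= λ dualᵖ →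
         companionDualMotions e-edge dualᵖ >>= λ dualᵠ →
         pinned count zero e-edge dualᵠ e₀ >>= λ x →
         pinned count zero e-edge dualᵠ e₁ >>= λ y →
         ¬¬-η (distance x y))
        where
        e-edge : ∀ a → Edge (List.lookup (edges (G - z)) (s a))
        e-edge a = edge-lookup (G - z) (s a)

        a b : Fin 3 → Point
        a i = p z ⊖ p⁻ (w i)
        b i = q z ⊖ q⁻ (w i)

        noncollinear : ∀ {i j} → i ≢ j → ¬ (det (a i) (a j) ≈ 0#)
        noncollinear i≢j = generic⇒noncollinear p generic
          (λ eq → Fin.punchInᵢ≢i z _ (≡.sym eq)) (λ eq → Fin.punchInᵢ≢i z _ (≡.sym eq))
          (λ eq → w-injective i≢j (Fin.punchIn-injective z _ _ eq))

        norm : ∀ i → a i · a i ≈ b i · b i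
        norm i = equivalent z (punchIn z (w i)) (adjacent i)

        distance : Pinned e₀ → Pinned e₁ → d (p⁻ (w zero) ⊖ p⁻ (w (suc zero)))
          ≈ d (q⁻ (w zero) ⊖ q⁻ (w (suc zero)))
        distance x y = begin
          d (p⁻ (w zero) ⊖ p⁻ (w (suc zero)))
            ≈⟨ polarise (p z) (p⁻ (w zero)) (p⁻ (w (suc zero))) ⟩
          (a zero · a zero + a (suc zero) · a (suc zero))
            + - (a zero · a (suc zero) + a zero · a (suc zero))
            ≈⟨ +-cong (+-cong (norm zero) (norm (suc zero))) (-‿cong (+-cong angle angle)) ⟩
          (b zero · b zero + b (suc zero) · b (suc zero))
            + - (b zero · b (suc zero) + b zero · b (suc zero))
            ≈⟨ polarise (q z) (q⁻ (w zero)) (q⁻ (w (suc zero))) ⟨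
          d (q⁻ (w zero) ⊖ q⁻ (w (suc zero))) ∎
          where
          module X = Pinned x
          module Y = Pinned y

          -- The law of cosines with apex `O`: with two side lengths known, only the scalar product
          -- at `O` remains to be compared.
          polarise : ∀ (O P Q : Point) → d (P ⊖ Q) ≈
            ((O ⊖ P) · (O ⊖ P) + (O ⊖ Q) · (O ⊖ Q)) + - ((O ⊖ P) · (O ⊖ Q) + (O ⊖ P) · (O ⊖ Q))
          polarise O P Q = solve 6 (λ o₀ o₁ x₀ x₁ y₀ y₁ →
            let dot = λ a b c d → a :* c :+ b :* d
                u₀ = o₀ :+ :- x₀ ; u₁ = o₁ :+ :- x₁ ; v₀ = o₀ :+ :- y₀ ; v₁ = o₁ :+ :- y₁
            in dot (x₀ :+ :- y₀) (x₁ :+ :- y₁) (x₀ :+ :- y₀) (x₁ :+ :- y₁) :=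
              (dot u₀ u₁ u₀ u₁ :+ dot v₀ v₁ v₀ v₁) :+ :- (dot u₀ u₁ v₀ v₁ :+ dot u₀ u₁ v₀ v₁))
            refl (O zero) (O (suc zero)) (P zero) (P (suc zero)) (Q zero) (Q (suc zero))

          angle : a zero · a (suc zero) ≈ b zero · b (suc zero)
          -- Velocities `e₀` and `e₁` of z pick out the coordinates of each `a i`; the pinned
          -- motions are the rows of N up to their scalars.
          angle = isometric-triple a b X.motion-z Y.motion-z X.scalar≉0 Y.scalar≉0
            (λ i → trans (X.at-z (w i) (adjacent i)) (*-congˡ (solve 2 (λ x y →
              x :* con 1ℚ :+ y :* con 0ℚ := x) refl _ _)))
            (λ i → trans (Y.at-z (w i) (adjacent i)) (*-congˡ (solve 2 (λ x y →
              x :* con 0ℚ :+ y :* con 1ℚ := y) refl _ _)))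
            norm (noncollinear λ ()) (noncollinear λ ()) (noncollinear λ ())

-- Removing a vertex with three neighbours

open ≡ using (refl)

theorem7p2 : ∀ {n : ℕ} (G : Graph (suc n)) (p : Complex.Realisation (suc n)) →
    Complex.Generic p →
    ∀ (u v v₁ v₂ v₃ vₙ : Fin (suc n)) →
    v₁ ≢ v₂ → v₁ ≢ v₃ → v₂ ≢ v₃ →
    (nbrs : N G vₙ ≐ ｛ v₁ ｝ ∪ ｛ v₂ ｝ ∪ ｛ v₃ ｝) →
    (vₙ≢u : vₙ ≢ u) (vₙ≢v : vₙ ≢ v) →
    let vₙ≢v₁ = N⇒≢ G (proj₂ nbrs (inj₁ refl))
        vₙ≢v₂ = N⇒≢ G (proj₂ nbrs (inj₂ (inj₁ refl)))
        H     = G - vₙ +⟨ punchOut vₙ≢v₁ , punchOut vₙ≢v₂ ⟩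
    in
    Rigid (G - vₙ) →
    Complex.GloballyLinked H (p ∘ punchIn vₙ) (punchOut vₙ≢u) (punchOut vₙ≢v) →
    Complex.GloballyLinked G p u v
theorem7p2 {n} G p generic u v v₁ v₂ v₃ vₙ v₁≢v₂ v₁≢v₃ v₂≢v₃ nbrs vₙ≢u vₙ≢v
  (p′ , generic′ , r , ((s , independent) , _) , count) linked q equivalent =
  ≡.subst₂ (λ a b → d (p a ⊖ p b) ≈ d (q a ⊖ q b)) (Fin.punchIn-punchOut vₙ≢u)
    (Fin.punchIn-punchOut vₙ≢v) (linked (q ∘ punchIn vₙ) equivalent-H)
  where
  open Complex using (d; _⊖_)
  open Domain ℂ-domain using (_≈_; sym; trans)

  neighbour : ∀ i → Graph._~_ G vₙ ((v₁ Vector.∷ v₂ Vector.∷ v₃ Vector.∷ Vector.[]) i)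
  neighbour zero             = proj₂ nbrs (inj₁ refl)
  neighbour (suc zero)       = proj₂ nbrs (inj₂ (inj₁ refl))
  neighbour (suc (suc zero)) = proj₂ nbrs (inj₂ (inj₂ refl))

  w : Fin 3 → Fin n
  w i = punchOut (N⇒≢ G (neighbour i))

  w-injective : ∀ {i j} → i ≢ j → w i ≢ w j
  w-injective {i} {j} i≢j eq = distinct i j i≢j
    (Fin.punchOut-injective (N⇒≢ G (neighbour i)) (N⇒≢ G (neighbour j)) eq)
    where
    distinct : ∀ i j → i ≢ j → let vs = v₁ Vector.∷ v₂ Vector.∷ v₃ Vector.∷ Vector.[] in
      vs i ≢ vs j
    distinct zero zero i≢j _ = i≢j refl
    distinct zero (suc zero) _ = v₁≢v₂
    distinct zero (suc (suc zero)) _ = v₁≢v₃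
    distinct (suc zero) zero _ = v₁≢v₂ ∘ ≡.sym
    distinct (suc zero) (suc zero) i≢j _ = i≢j refl
    distinct (suc zero) (suc (suc zero)) _ = v₂≢v₃
    distinct (suc (suc zero)) zero _ = v₁≢v₃ ∘ ≡.sym
    distinct (suc (suc zero)) (suc zero) _ = v₂≢v₃ ∘ ≡.sym
    distinct (suc (suc zero)) (suc (suc zero)) i≢j _ = i≢j refl

  adjacent : ∀ i → Graph._~_ G vₙ (punchIn vₙ (w i))
  adjacent i = ≡.subst (Graph._~_ G vₙ) (≡.sym (Fin.punchIn-punchOut (N⇒≢ G (neighbour i))))
    (neighbour i)

  p⁻ q⁻ : Complex.Realisation n
  p⁻ = p ∘ punchIn vₙ
  q⁻ = q ∘ punchIn vₙ

  new-edge : d (p⁻ (w zero) ⊖ p⁻ (w (suc zero))) ≈ d (q⁻ (w zero) ⊖ q⁻ (w (suc zero)))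
  new-edge = neighbours-distance ℂ-domain ℝ-domain G p q generic equivalent vₙ p′ generic′
    s independent count w w-injective adjacent

  equivalent-H : Complex.Equivalent (G - vₙ +⟨ w zero , w (suc zero) ⟩) p⁻ q⁻
  equivalent-H a b (inj₁ a~b) = equivalent (punchIn vₙ a) (punchIn vₙ b) a~b
  equivalent-H a b (inj₂ (_ , inj₁ (refl , refl))) = new-edge
  equivalent-H a b (inj₂ (_ , inj₂ (refl , refl))) =
    trans {d (p⁻ a ⊖ p⁻ b)} {d (p⁻ b ⊖ p⁻ a)} {d (q⁻ a ⊖ q⁻ b)} (d-symmetric ℂ-algebra (p⁻ a) (p⁻ b))
      (trans {d (p⁻ b ⊖ p⁻ a)} {d (q⁻ b ⊖ q⁻ a)} {d (q⁻ a ⊖ q⁻ b)} new-edge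
        (d-symmetric ℂ-algebra (q⁻ b) (q⁻ a)))
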